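{- Let $(a_i)_{i\ge0}$ be integers with $a_0=0$, $a_1=2$, $a_{2k}=4$ for all $k\geq1$, and $a_{2k+1}$ arbitrary positive integers for $k\ge1$. Let $\ell=[a_0;a_1,a_2,\dots]$ (an irrational number) and $\theta=e^{2/\ell}$. Then $\mathcal A_\theta$ is infinite. In particular, for every positive integer $c$, if $\theta=e^{4-c+\sqrt{c(c+1)}}$ then $\mathcal A_\theta$ is infinite.
   Context: $\lfloor x\rfloor$ is the floor of $x$; $\log$ is the natural logarithm. For real $\theta>1$ and positive integer $n$, $M'_\theta(n)=\left\lfloor 1/(\theta^{1/n}-1)\right\rfloor$, and $\mathcal A_\theta=\{n\in\mathbb N: M'_\theta(n)\neq \lfloor n/\log\theta-1/2\rfloor\}$, where $\mathbb N$ is the set of positive integers. $[a_0;a_1,a_2,\dots]$ denotes an infinite simple continued fraction. -}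

module Defs where

open import Data.Integer using (ℤ; +_; -[1+_]; 0ℤ; 1ℤ)
import Data.Integer as ℤ
import Data.Integer.Properties as ℤₚ
open import Data.Nat using (ℕ; zero; suc; NonZero)
import Data.Nat as ℕ
import Data.Nat.Properties as ℕₚ
open import Data.Product using (Σ-syntax; ∃-syntax; _×_; _,_)
open import Data.Rational using (ℚ; 0ℚ; 1ℚ; ½; _/_)
import Data.Rational as ℚ
open import Data.Sum using (_⊎_; inj₁; inj₂)
open import Function using (_∘_)
open import Relation.Binary.PropositionalEquality using (_≡_; _≢_; refl; sym; trans; cong; cong₂; subst; subst₂)
open import Relation.Nullary using (yes; no; contradiction)

module RationalSequences where

  open import Algebra.Definitions.RawSemiring ℚ.+-*-rawSemiring using (_^_)
  open import Data.Rational using (_+_; _*_; _-_; -_; _≤_; _<_; ∣_∣; 1/_; Positive; NonNegative; positive; nonNegative)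
  open import Data.Rational.Properties
  open import Data.Rational.Solver using (module +-*-Solver)
  import Data.Rational.Unnormalised as ℚᵘ
  import Data.Rational.Unnormalised.Properties as ℚᵘₚ
  open +-*-Solver using (solve; _:=_; _:+_; _:*_; _:-_; :-_; con)
  open ≤-Reasoning

  IsCauchy : (ℕ → ℚ) → Set
  IsCauchy s = ∀ ε → 0ℚ < ε → ∃[ N ] ∀ m n → N ℕ.≤ m → N ℕ.≤ n → ∣ s m - s n ∣ < ε

  BoundedAwayFrom0 : (ℕ → ℚ) → Set
  BoundedAwayFrom0 s = ∃[ ε ] 0ℚ < ε × ∃[ N ] ∀ n → N ℕ.≤ n → ε ≤ ∣ s n ∣

  -- Reciprocal with the convention inv 0 = 0.
  inv : ℚ → ℚ
  inv p with p ≟ 0ℚ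
  ... | yes _   = 0ℚ
  ... | no p≢0 = (1/ p) {{ℚ.≢-nonZero p≢0}}

  expTerm : ℚ → ℕ → ℚ
  expTerm x k = x ^ k * (_/_ (+ 1) (k ℕ.!) {{ℕₚ._!≢0 k}})

  -- The sum of the terms with k < n.
  expSum : ℚ → ℕ → ℚ
  expSum x zero    = 0ℚ
  expSum x (suc n) = expSum x n + expTerm x n

  -- [a₀; a₁, …, aₙ]; inv is only ever applied to numbers ≥ 1 when aᵢ > 0 for i ≥ 1.
  convergent : (ℕ → ℤ) → ℕ → ℚ
  convergent a zero    = a 0 / 1
  convergent a (suc n) = a 0 / 1 + inv (convergent (a ∘ suc) n)

  *-inv : ∀ p → p ≢ 0ℚ → p * inv p ≡ 1ℚ
  *-inv p p≢0 with p ≟ 0ℚ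
  ... | yes p≡0 = contradiction p≡0 p≢0
  ... | no  q≢0 = *-inverseʳ p {{ℚ.≢-nonZero q≢0}}

  0<⇒≢0 : ∀ {p} → 0ℚ < p → p ≢ 0ℚ
  0<⇒≢0 0<p p≡0 = <-irrefl (sym p≡0) 0<p

  0<1 : 0ℚ < 1ℚ
  0<1 = positive⁻¹ 1ℚ

  *-mono-0≤ : ∀ {p q} → 0ℚ ≤ p → 0ℚ ≤ q → 0ℚ ≤ p * q
  *-mono-0≤ {p} {q} 0≤p 0≤q = nonNegative⁻¹ (p * q) {{nonNeg*nonNeg⇒nonNeg p {{nonNegative 0≤p}} q {{nonNegative 0≤q}}}}

  *-mono-0< : ∀ {p q} → 0ℚ < p → 0ℚ < q → 0ℚ < p * q
  *-mono-0< {p} {q} 0<p 0<q = positive⁻¹ (p * q) {{pos*pos⇒pos p {{positive 0<p}} q {{positive 0<q}}}}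

  *-monoʳ : ∀ {p q} r → 0ℚ ≤ r → p ≤ q → p * r ≤ q * r
  *-monoʳ r 0≤r = *-monoʳ-≤-nonNeg r {{nonNegative 0≤r}}

  *-monoˡ : ∀ {p q} r → 0ℚ ≤ r → p ≤ q → r * p ≤ r * q
  *-monoˡ r 0≤r = *-monoˡ-≤-nonNeg r {{nonNegative 0≤r}}

  *-mono : ∀ {p q r s} → 0ℚ ≤ r → 0ℚ ≤ q → p ≤ q → r ≤ s → p * r ≤ q * s
  *-mono {r = r} 0≤r 0≤q p≤q r≤s = ≤-trans (*-monoʳ r 0≤r p≤q) (*-monoˡ _ 0≤q r≤s)

  *-cancelˡ-< : ∀ r {p q} → 0ℚ < r → r * p < r * q → p < q
  *-cancelˡ-< r 0<r = *-cancelˡ-<-nonNeg r {{nonNegative (<⇒≤ 0<r)}}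

  *-cancelˡ-≤ : ∀ r {p q} → 0ℚ < r → r * p ≤ r * q → p ≤ q
  *-cancelˡ-≤ r 0<r = *-cancelˡ-≤-pos r {{positive 0<r}}

  inv-0< : ∀ {p} → 0ℚ < p → 0ℚ < inv p
  inv-0< {p} 0<p = *-cancelˡ-< p 0<p (subst₂ _<_ (sym (*-zeroʳ p)) (sym (*-inv p (0<⇒≢0 0<p))) 0<1)

  inv-antimono : ∀ {p q} → 0ℚ < p → p ≤ q → inv q ≤ inv p
  inv-antimono {p} {q} 0<p p≤q = *-cancelˡ-≤ p 0<p (begin
    p * inv q ≤⟨ *-monoʳ (inv q) (<⇒≤ (inv-0< 0<q)) p≤q ⟩
    q * inv q ≡⟨ *-inv q (0<⇒≢0 0<q) ⟩
    1ℚ        ≡⟨ *-inv p (0<⇒≢0 0<p) ⟨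
    p * inv p ∎)
    where 0<q = <-≤-trans 0<p p≤q

  +-diff : ∀ a b c d → (a + b) - (c + d) ≡ (a - c) + (b - d)
  +-diff = solve 4 (λ a b c d → (a :+ b) :- (c :+ d) := (a :- c) :+ (b :- d)) refl

  *-diff : ∀ a b c d → a * b - c * d ≡ a * (b - d) + d * (a - c)
  *-diff = solve 4 (λ a b c d → a :* b :- c :* d := a :* (b :- d) :+ d :* (a :- c)) refl

  inv-diff : ∀ a b → a ≢ 0ℚ → b ≢ 0ℚ → a * b * (inv a - inv b) ≡ b - a
  inv-diff a b a≢0 b≢0 = begin-equality
    a * b * (inv a - inv b)         ≡⟨ rearrange a b (inv a) (inv b) ⟩
    a * inv a * b - b * inv b * a   ≡⟨ cong₂ (λ x y → x * b - y * a) (*-inv a a≢0) (*-inv b b≢0) ⟩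
    1ℚ * b - 1ℚ * a                 ≡⟨ cong₂ _-_ (*-identityˡ b) (*-identityˡ a) ⟩
    b - a                           ∎
    where
    rearrange : ∀ a b x y → a * b * (x - y) ≡ a * x * b - b * y * a
    rearrange = solve 4 (λ a b x y → a :* b :* (x :- y) := a :* x :* b :- b :* y :* a) refl

  ∣-∣-comm : ∀ p q → ∣ p - q ∣ ≡ ∣ q - p ∣
  ∣-∣-comm p q = trans (cong ∣_∣ (solve 2 (λ p q → p :- q := :- (q :- p)) refl p q)) (∣-p∣≡∣p∣ (q - p))

  ∣-∣-triangle : ∀ p q r → ∣ p - r ∣ ≤ ∣ p - q ∣ + ∣ q - r ∣
  ∣-∣-triangle p q r = subst (λ d → ∣ d ∣ ≤ ∣ p - q ∣ + ∣ q - r ∣)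
    (solve 3 (λ p q r → (p :- q) :+ (q :- r) := p :- r) refl p q r)
    (∣p+q∣≤∣p∣+∣q∣ (p - q) (q - r))

  ∣-∣≤ : ∀ {p q r} → p ≤ q + r → q ≤ p + r → ∣ p - q ∣ ≤ r
  ∣-∣≤ {p} {q} {r} p≤q+r q≤p+r with ∣p∣≡p∨∣p∣≡-p (p - q)
  ... | inj₁ eq = begin
    ∣ p - q ∣   ≡⟨ eq ⟩
    p - q       ≤⟨ +-monoˡ-≤ (- q) p≤q+r ⟩
    q + r - q   ≡⟨ solve 2 (λ q r → q :+ r :- q := r) refl q r ⟩
    r           ∎
  ... | inj₂ eq = begin
    ∣ p - q ∣   ≡⟨ eq ⟩
    - (p - q)   ≡⟨ solve 2 (λ p q → :- (p :- q) := q :- p) refl p q ⟩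
    q - p       ≤⟨ +-monoˡ-≤ (- p) q≤p+r ⟩
    p + r - p   ≡⟨ solve 2 (λ p r → p :+ r :- p := r) refl p r ⟩
    r           ∎

  ∣p∣≤∣q∣+∣p-q∣ : ∀ p q → ∣ p ∣ ≤ ∣ q ∣ + ∣ p - q ∣
  ∣p∣≤∣q∣+∣p-q∣ p q = subst (λ r → ∣ r ∣ ≤ ∣ q ∣ + ∣ p - q ∣)
    (solve 2 (λ p q → q :+ (p :- q) := p) refl p q) (∣p+q∣≤∣p∣+∣q∣ q (p - q))

  p≤p+q : ∀ {p q} → 0ℚ ≤ q → p ≤ p + q
  p≤p+q {p} {q} 0≤q = subst (_≤ p + q) (+-identityʳ p) (+-monoʳ-≤ p 0≤q)

  ½*ε+½*ε : ∀ ε → ½ * ε + ½ * ε ≡ ε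
  ½*ε+½*ε = solve 1 (λ ε → con ½ :* ε :+ con ½ :* ε := ε) refl

  0<½*ε : ∀ ε → 0ℚ < ε → 0ℚ < ½ * ε
  0<½*ε ε = *-mono-0< {½} {ε} (positive⁻¹ ½)

  abstract
    divide : ∀ K ε → 0ℚ < K → 0ℚ < ε → ∃[ δ ] 0ℚ < δ × K * δ ≡ ε
    divide K ε 0<K 0<ε = inv K * ε , *-mono-0< (inv-0< 0<K) 0<ε ,
      trans (sym (*-assoc K (inv K) ε)) (trans (cong (_* ε) (*-inv K (0<⇒≢0 0<K))) (*-identityˡ ε))

  *-<-bound : ∀ u v K δ → 0ℚ ≤ v → 0ℚ < K → u ≤ K → v < δ → u * v < K * δ
  *-<-bound u v K δ 0≤v 0<K u≤K v<δ = ≤-<-trans (*-monoʳ v 0≤v u≤K) (*-monoʳ-<-pos K {{positive 0<K}} v<δ)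

  /1-+ : ∀ i j → (i ℤ.+ j) / 1 ≡ i / 1 + j / 1
  /1-+ i j = toℚᵘ-injective (ℚᵘₚ.≃-trans (toℚᵘ-fromℚᵘ (ℚᵘ.mkℚᵘ (i ℤ.+ j) 0))
    (ℚᵘₚ.≃-sym (ℚᵘₚ.≃-trans (toℚᵘ-homo-+ (i / 1) (j / 1))
      (ℚᵘₚ.≃-trans (ℚᵘₚ.+-cong (toℚᵘ-fromℚᵘ (ℚᵘ.mkℚᵘ i 0)) (toℚᵘ-fromℚᵘ (ℚᵘ.mkℚᵘ j 0)))
        (ℚᵘ.*≡* (cong (ℤ._* 1ℤ) (cong₂ ℤ._+_ (ℤₚ.*-identityʳ i) (ℤₚ.*-identityʳ j))))))))

  /1-mono : ∀ {i j} → i ℤ.≤ j → i / 1 ≤ j / 1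
  /1-mono {i} {j} i≤j = toℚᵘ-cancel-≤ (ℚᵘₚ.≤-respˡ-≃ (ℚᵘₚ.≃-sym (toℚᵘ-fromℚᵘ (ℚᵘ.mkℚᵘ i 0)))
    (ℚᵘₚ.≤-respʳ-≃ (ℚᵘₚ.≃-sym (toℚᵘ-fromℚᵘ (ℚᵘ.mkℚᵘ j 0)))
      (ℚᵘ.*≤* (ℤₚ.*-monoʳ-≤-nonNeg 1ℤ i≤j))))

  ι : ℕ → ℚ
  ι n = + n / 1

  ι-suc : ∀ n → ι (suc n) ≡ 1ℚ + ι n
  ι-suc n = /1-+ 1ℤ (+ n)

  0≤ι : ∀ n → 0ℚ ≤ ι n
  0≤ι n = /1-mono {0ℤ} {+ n} (ℤ.+≤+ ℕ.z≤n)

  0<ι-suc : ∀ n → 0ℚ < ι (suc n)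
  0<ι-suc n = <-≤-trans 0<1 (/1-mono {1ℤ} {+ suc n} (ℤ.+≤+ (ℕ.s≤s ℕ.z≤n)))

  archimedean : ∀ q → ∃[ K ] q ≤ ι K
  archimedean q@(ℚ.mkℚ (+ n) d-1 _) = n , toℚᵘ-cancel-≤ (ℚᵘₚ.≤-respʳ-≃ (ℚᵘₚ.≃-sym (toℚᵘ-fromℚᵘ (ℚᵘ.mkℚᵘ (+ n) 0)))
    (ℚᵘ.*≤* (ℤₚ.*-monoˡ-≤-nonNeg (+ n) (ℤ.+≤+ (ℕ.s≤s ℕ.z≤n)))))
  archimedean q@(ℚ.mkℚ -[1+ n ] d-1 _) = 0 , <⇒≤ (negative⁻¹ q)

  ι-unbounded : ∀ {ε B} → 0ℚ < ε → ∃[ K ] ∀ k → K ℕ.≤ k → B < ι (suc k) * ε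
  ι-unbounded {ε} {B} 0<ε with archimedean (B * inv ε)
  ... | K , B/ε≤K = K , λ k K≤k → begin-strict
    B               ≡⟨ *-identityʳ B ⟨
    B * 1ℚ          ≡⟨ cong (B *_) (*-inv ε (0<⇒≢0 0<ε)) ⟨
    B * (ε * inv ε) ≡⟨ solve 3 (λ b e i → b :* (e :* i) := e :* (b :* i)) refl B ε (inv ε) ⟩
    ε * (B * inv ε) ≤⟨ *-monoˡ ε (<⇒≤ 0<ε) (≤-trans B/ε≤K (/1-mono {+ K} {+ k} (ℤ.+≤+ K≤k))) ⟩
    ε * ι k         <⟨ *-monoʳ-<-pos ε {{positive 0<ε}} (subst₂ _<_ (+-identityˡ (ι k)) (sym (ι-suc k)) (+-monoˡ-< (ι k) 0<1)) ⟩
    ε * ι (suc k)   ≡⟨ *-comm ε (ι (suc k)) ⟩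
    ι (suc k) * ε   ∎

  const-isCauchy : ∀ q → IsCauchy (λ _ → q)
  const-isCauchy q ε 0<ε = 0 , λ _ _ _ _ → subst (_< ε) (sym (cong ∣_∣ (+-inverseʳ q))) 0<ε

  eventually-bounded : ∀ {s} → IsCauchy s → ∃[ B ] 0ℚ < B × ∃[ N ] ∀ n → N ℕ.≤ n → ∣ s n ∣ ≤ B
  eventually-bounded {s} s-cauchy with s-cauchy 1ℚ 0<1
  ... | N , close = ∣ s N ∣ + 1ℚ , <-≤-trans 0<1 (subst (_≤ ∣ s N ∣ + 1ℚ) (+-identityˡ 1ℚ) (+-monoˡ-≤ 1ℚ (0≤∣p∣ (s N)))) , N ,
    λ n N≤n → ≤-trans (∣p∣≤∣q∣+∣p-q∣ (s n) (s N)) (+-monoʳ-≤ ∣ s N ∣ (<⇒≤ (close n N N≤n ℕₚ.≤-refl)))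

  +-isCauchy : ∀ {s t} → IsCauchy s → IsCauchy t → IsCauchy (λ n → s n + t n)
  +-isCauchy {s} {t} s-cauchy t-cauchy ε 0<ε =
    let M , sM = s-cauchy (½ * ε) (0<½*ε ε 0<ε)
        N , tN = t-cauchy (½ * ε) (0<½*ε ε 0<ε)
    in M ℕ.⊔ N , λ m n m≥ n≥ → begin-strict
    ∣ (s m + t m) - (s n + t n) ∣   ≡⟨ cong ∣_∣ (+-diff (s m) (t m) (s n) (t n)) ⟩
    ∣ (s m - s n) + (t m - t n) ∣   ≤⟨ ∣p+q∣≤∣p∣+∣q∣ (s m - s n) (t m - t n) ⟩
    ∣ s m - s n ∣ + ∣ t m - t n ∣   <⟨ +-mono-< (sM m n (ℕₚ.m⊔n≤o⇒m≤o M N m≥) (ℕₚ.m⊔n≤o⇒m≤o M N n≥))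
                                                (tN m n (ℕₚ.m⊔n≤o⇒n≤o M N m≥) (ℕₚ.m⊔n≤o⇒n≤o M N n≥)) ⟩
    ½ * ε + ½ * ε                   ≡⟨ ½*ε+½*ε ε ⟩
    ε                               ∎

  neg-isCauchy : ∀ {s} → IsCauchy s → IsCauchy (λ n → - s n)
  neg-isCauchy {s} s-cauchy ε 0<ε with s-cauchy ε 0<ε
  ... | N , sN = N , λ m n m≥ n≥ → subst (_< ε)
    (trans (∣-∣-comm (s m) (s n)) (cong ∣_∣ (solve 2 (λ a b → b :- a := (:- a) :- (:- b)) refl (s m) (s n))))
    (sN m n m≥ n≥)

  *-close : ∀ a b c d A B α β → 0ℚ < A → 0ℚ < B → ∣ a ∣ ≤ A → ∣ d ∣ ≤ B →
            ∣ b - d ∣ < α → ∣ a - c ∣ < β → ∣ a * b - c * d ∣ < A * α + B * β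
  *-close a b c d A B α β 0<A 0<B a≤A d≤B b-d<α a-c<β = begin-strict
    ∣ a * b - c * d ∣                       ≡⟨ cong ∣_∣ (*-diff a b c d) ⟩
    ∣ a * (b - d) + d * (a - c) ∣           ≤⟨ ∣p+q∣≤∣p∣+∣q∣ (a * (b - d)) (d * (a - c)) ⟩
    ∣ a * (b - d) ∣ + ∣ d * (a - c) ∣       ≡⟨ cong₂ _+_ (∣p*q∣≡∣p∣*∣q∣ a (b - d)) (∣p*q∣≡∣p∣*∣q∣ d (a - c)) ⟩
    ∣ a ∣ * ∣ b - d ∣ + ∣ d ∣ * ∣ a - c ∣   <⟨ +-mono-< {∣ a ∣ * ∣ b - d ∣} {A * α} {∣ d ∣ * ∣ a - c ∣} {B * β}
                                                 (*-<-bound ∣ a ∣ ∣ b - d ∣ A α (0≤∣p∣ (b - d)) 0<A a≤A b-d<α)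
                                                 (*-<-bound ∣ d ∣ ∣ a - c ∣ B β (0≤∣p∣ (a - c)) 0<B d≤B a-c<β) ⟩
    A * α + B * β                           ∎

  *-isCauchy : ∀ {s t} → IsCauchy s → IsCauchy t → IsCauchy (λ n → s n * t n)
  *-isCauchy {s} {t} s-cauchy t-cauchy ε 0<ε =
    let A , 0<A , K , s≤A = eventually-bounded {s} s-cauchy
        B , 0<B , L , t≤B = eventually-bounded {t} t-cauchy
        α , 0<α , Aα≡ = divide A (½ * ε) 0<A (0<½*ε ε 0<ε)
        β , 0<β , Bβ≡ = divide B (½ * ε) 0<B (0<½*ε ε 0<ε)
        M , sM = s-cauchy β 0<β
        N , tN = t-cauchy α 0<α
    in (K ℕ.⊔ L) ℕ.⊔ (M ℕ.⊔ N) , λ m n m≥ n≥ →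
    let K≤m = ℕₚ.m⊔n≤o⇒m≤o K L (ℕₚ.m⊔n≤o⇒m≤o (K ℕ.⊔ L) (M ℕ.⊔ N) m≥)
        L≤n = ℕₚ.m⊔n≤o⇒n≤o K L (ℕₚ.m⊔n≤o⇒m≤o (K ℕ.⊔ L) (M ℕ.⊔ N) n≥)
        M⊔N≤m = ℕₚ.m⊔n≤o⇒n≤o (K ℕ.⊔ L) (M ℕ.⊔ N) m≥
        M⊔N≤n = ℕₚ.m⊔n≤o⇒n≤o (K ℕ.⊔ L) (M ℕ.⊔ N) n≥
    in subst (∣ s m * t m - s n * t n ∣ <_) (trans (cong₂ _+_ Aα≡ Bβ≡) (½*ε+½*ε ε))
      (*-close (s m) (t m) (s n) (t n) A B α β 0<A 0<B (s≤A m K≤m) (t≤B n L≤n)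
        (tN m n (ℕₚ.m⊔n≤o⇒n≤o M N M⊔N≤m) (ℕₚ.m⊔n≤o⇒n≤o M N M⊔N≤n))
        (sM m n (ℕₚ.m⊔n≤o⇒m≤o M N M⊔N≤m) (ℕₚ.m⊔n≤o⇒m≤o M N M⊔N≤n)))

  ε≤∣p∣⇒p≢0 : ∀ {ε p} → 0ℚ < ε → ε ≤ ∣ p ∣ → p ≢ 0ℚ
  ε≤∣p∣⇒p≢0 0<ε ε≤∣p∣ refl = <-irrefl refl (<-≤-trans 0<ε ε≤∣p∣)

  inv-isCauchy : ∀ {s} → IsCauchy s → BoundedAwayFrom0 s → IsCauchy (λ n → inv (s n))
  inv-isCauchy {s} s-cauchy (η , 0<η , M , η≤s) ε 0<ε =
    let N , sN = s-cauchy (η * η * ε) (*-mono-0< {η * η} {ε} (*-mono-0< 0<η 0<η) 0<ε)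
    in M ℕ.⊔ N , λ m n m≥ n≥ → close (s m) (s n)
      (η≤s m (ℕₚ.m⊔n≤o⇒m≤o M N m≥)) (η≤s n (ℕₚ.m⊔n≤o⇒m≤o M N n≥))
      (sN m n (ℕₚ.m⊔n≤o⇒n≤o M N m≥) (ℕₚ.m⊔n≤o⇒n≤o M N n≥))
    where
    close : ∀ a b → η ≤ ∣ a ∣ → η ≤ ∣ b ∣ → ∣ a - b ∣ < η * η * ε → ∣ inv a - inv b ∣ < ε
    close a b η≤∣a∣ η≤∣b∣ a-b< = *-cancelˡ-< (η * η) {∣ inv a - inv b ∣} {ε} (*-mono-0< 0<η 0<η) (begin-strict
      η * η * ∣ inv a - inv b ∣           ≤⟨ *-monoʳ ∣ inv a - inv b ∣ (0≤∣p∣ (inv a - inv b)) (*-mono (<⇒≤ 0<η) (0≤∣p∣ a) η≤∣a∣ η≤∣b∣) ⟩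
      ∣ a ∣ * ∣ b ∣ * ∣ inv a - inv b ∣   ≡⟨ cong (_* ∣ inv a - inv b ∣) (∣p*q∣≡∣p∣*∣q∣ a b) ⟨
      ∣ a * b ∣ * ∣ inv a - inv b ∣       ≡⟨ ∣p*q∣≡∣p∣*∣q∣ (a * b) (inv a - inv b) ⟨
      ∣ a * b * (inv a - inv b) ∣         ≡⟨ cong ∣_∣ (inv-diff a b (ε≤∣p∣⇒p≢0 0<η η≤∣a∣) (ε≤∣p∣⇒p≢0 0<η η≤∣b∣)) ⟩
      ∣ b - a ∣                           ≡⟨ ∣-∣-comm b a ⟩
      ∣ a - b ∣                           <⟨ a-b< ⟩
      η * η * ε                           ∎)

  1/!-suc : ∀ m d .{{_ : NonZero m}} .{{_ : NonZero d}} .{{_ : NonZero (m ℕ.* d)}} → (+ m / 1) * (+ 1 / (m ℕ.* d)) ≡ + 1 / d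
  1/!-suc (suc m) (suc d) = toℚᵘ-injective
    (ℚᵘₚ.≃-trans (toℚᵘ-homo-* (+ suc m / 1) (+ 1 / (suc m ℕ.* suc d)))
    (ℚᵘₚ.≃-trans (ℚᵘₚ.*-cong (toℚᵘ-fromℚᵘ (ℚᵘ.mkℚᵘ (+ suc m) 0)) (toℚᵘ-fromℚᵘ (ℚᵘ.mkℚᵘ (+ 1) (d ℕ.+ m ℕ.* suc d))))
    (ℚᵘₚ.≃-trans (ℚᵘ.*≡* (cong +_ nat))
      (ℚᵘₚ.≃-sym (toℚᵘ-fromℚᵘ (ℚᵘ.mkℚᵘ (+ 1) d))))))
    where
    nat : (suc m ℕ.* 1) ℕ.* suc d ≡ 1 ℕ.* (1 ℕ.* suc (d ℕ.+ m ℕ.* suc d))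
    nat = trans (cong (ℕ._* suc d) (ℕₚ.*-identityʳ (suc m))) (sym (trans (ℕₚ.*-identityˡ _) (ℕₚ.*-identityˡ _)))

  expTerm-suc : ∀ x k → ι (suc k) * expTerm x (suc k) ≡ x * expTerm x k
  expTerm-suc x k = trans (rearrange (ι (suc k)) x (x ^ k) r′) (cong (λ r → x * (x ^ k * r)) (1/!-suc (suc k) (k ℕ.!) {{_}} {{ℕₚ._!≢0 k}} {{ℕₚ._!≢0 (suc k)}}))
    where
    r′ = _/_ (+ 1) (suc k ℕ.!) {{ℕₚ._!≢0 (suc k)}}
    rearrange : ∀ i x p r → i * (x * p * r) ≡ x * (p * (i * r))
    rearrange = solve 4 (λ i x p r → i :* (x :* p :* r) := x :* (p :* (i :* r))) refl

  ∣ι∣ : ∀ k → ∣ ι k ∣ ≡ ι k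
  ∣ι∣ k = 0≤p⇒∣p∣≡p (0≤ι k)

  0≤expTerm : ∀ B → 0ℚ ≤ B → ∀ k → 0ℚ ≤ expTerm B k
  0≤expTerm B 0≤B zero    = <⇒≤ 0<1
  0≤expTerm B 0≤B (suc k) = *-cancelˡ-≤ (ι (suc k)) {0ℚ} {expTerm B (suc k)} (0<ι-suc k)
    (subst₂ _≤_ (sym (*-zeroʳ (ι (suc k)))) (sym (expTerm-suc B k)) (*-mono-0≤ {B} {expTerm B k} 0≤B (0≤expTerm B 0≤B k)))

  ∣expTerm∣≤ : ∀ x B → ∣ x ∣ ≤ B → ∀ k → ∣ expTerm x k ∣ ≤ expTerm B k
  ∣expTerm∣≤ x B x≤B zero    = ≤-refl
  ∣expTerm∣≤ x B x≤B (suc k) = *-cancelˡ-≤ (ι (suc k)) {∣ expTerm x (suc k) ∣} {expTerm B (suc k)} (0<ι-suc k) (begin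
    ι (suc k) * ∣ expTerm x (suc k) ∣       ≡⟨ cong (_* ∣ expTerm x (suc k) ∣) (∣ι∣ (suc k)) ⟨
    ∣ ι (suc k) ∣ * ∣ expTerm x (suc k) ∣   ≡⟨ ∣p*q∣≡∣p∣*∣q∣ (ι (suc k)) (expTerm x (suc k)) ⟨
    ∣ ι (suc k) * expTerm x (suc k) ∣       ≡⟨ cong ∣_∣ (expTerm-suc x k) ⟩
    ∣ x * expTerm x k ∣                     ≡⟨ ∣p*q∣≡∣p∣*∣q∣ x (expTerm x k) ⟩
    ∣ x ∣ * ∣ expTerm x k ∣                 ≤⟨ *-mono {∣ x ∣} {B} {∣ expTerm x k ∣} {expTerm B k} (0≤∣p∣ (expTerm x k)) (≤-trans (0≤∣p∣ x) x≤B) x≤B (∣expTerm∣≤ x B x≤B k) ⟩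
    B * expTerm B k                         ≡⟨ expTerm-suc B k ⟨
    ι (suc k) * expTerm B (suc k)           ∎)

  expTerm-lipschitz : ∀ x y B → ∣ x ∣ ≤ B → ∣ y ∣ ≤ B → ∀ k →
                      ∣ expTerm x (suc k) - expTerm y (suc k) ∣ ≤ ∣ x - y ∣ * expTerm B k
  expTerm-lipschitz x y B x≤B y≤B k = *-cancelˡ-≤ (ι (suc k)) {∣ dₖ₊₁ ∣} {δ * b} (0<ι-suc k) (begin
    ι (suc k) * ∣ dₖ₊₁ ∣            ≡⟨ cong (_* ∣ dₖ₊₁ ∣) (∣ι∣ (suc k)) ⟨
    ∣ ι (suc k) ∣ * ∣ dₖ₊₁ ∣        ≡⟨ ∣p*q∣≡∣p∣*∣q∣ (ι (suc k)) dₖ₊₁ ⟨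
    ∣ ι (suc k) * dₖ₊₁ ∣            ≡⟨ cong ∣_∣ step ⟩
    ∣ x * dₖ + tₖ * (x - y) ∣       ≤⟨ ∣p+q∣≤∣p∣+∣q∣ (x * dₖ) (tₖ * (x - y)) ⟩
    ∣ x * dₖ ∣ + ∣ tₖ * (x - y) ∣   ≡⟨ cong₂ _+_ (∣p*q∣≡∣p∣*∣q∣ x dₖ) (∣p*q∣≡∣p∣*∣q∣ tₖ (x - y)) ⟩
    ∣ x ∣ * ∣ dₖ ∣ + ∣ tₖ ∣ * δ     ≤⟨ +-mono-≤ {∣ x ∣ * ∣ dₖ ∣} {δ * (ι k * b)} {∣ tₖ ∣ * δ} {b * δ}
                                         (xdₖ k) (*-monoʳ {∣ tₖ ∣} {b} δ (0≤∣p∣ (x - y)) (∣expTerm∣≤ y B y≤B k)) ⟩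
    δ * (ι k * b) + b * δ           ≡⟨ collect δ (ι k) b ⟩
    (1ℚ + ι k) * (δ * b)            ≡⟨ cong (_* (δ * b)) (ι-suc k) ⟨
    ι (suc k) * (δ * b)             ∎)
    where
    b = expTerm B k
    δ = ∣ x - y ∣
    dₖ₊₁ = expTerm x (suc k) - expTerm y (suc k)
    dₖ = expTerm x k - expTerm y k
    tₖ = expTerm y k
    0≤B = ≤-trans (0≤∣p∣ x) x≤B
    *-distribˡ-- : ∀ i p q → i * (p - q) ≡ i * p - i * q
    *-distribˡ-- = solve 3 (λ i p q → i :* (p :- q) := i :* p :- i :* q) refl
    collect : ∀ d i b → d * (i * b) + b * d ≡ (1ℚ + i) * (d * b)
    collect = solve 3 (λ d i b → d :* (i :* b) :+ b :* d := (con 1ℚ :+ i) :* (d :* b)) refl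
    step : ι (suc k) * dₖ₊₁ ≡ x * dₖ + tₖ * (x - y)
    step = trans (*-distribˡ-- (ι (suc k)) (expTerm x (suc k)) (expTerm y (suc k)))
      (trans (cong₂ _-_ (expTerm-suc x k) (expTerm-suc y k)) (*-diff x (expTerm x k) y (expTerm y k)))
    xdₖ : ∀ k → ∣ x ∣ * ∣ expTerm x k - expTerm y k ∣ ≤ ∣ x - y ∣ * (ι k * expTerm B k)
    xdₖ zero = ≤-reflexive (trans (*-zeroʳ ∣ x ∣) (sym (*-zeroʳ ∣ x - y ∣)))
    xdₖ (suc k) = begin
      ∣ x ∣ * ∣ expTerm x (suc k) - expTerm y (suc k) ∣
        ≤⟨ *-mono {∣ x ∣} {B} {∣ expTerm x (suc k) - expTerm y (suc k) ∣} {∣ x - y ∣ * expTerm B k}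
             (0≤∣p∣ (expTerm x (suc k) - expTerm y (suc k))) 0≤B x≤B (expTerm-lipschitz x y B x≤B y≤B k) ⟩
      B * (∣ x - y ∣ * expTerm B k)
        ≡⟨ swap B ∣ x - y ∣ (expTerm B k) ⟩
      ∣ x - y ∣ * (B * expTerm B k)
        ≡⟨ cong (∣ x - y ∣ *_) (expTerm-suc B k) ⟨
      ∣ x - y ∣ * (ι (suc k) * expTerm B (suc k)) ∎
      where
      swap : ∀ p q r → p * (q * r) ≡ q * (p * r)
      swap = solve 3 (λ p q r → p :* (q :* r) := q :* (p :* r)) refl

  expSum-lipschitz : ∀ x y B → ∣ x ∣ ≤ B → ∣ y ∣ ≤ B → ∀ n →
                     ∣ expSum x (suc n) - expSum y (suc n) ∣ ≤ ∣ x - y ∣ * expSum B n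
  expSum-lipschitz x y B x≤B y≤B zero    = ≤-reflexive (sym (*-zeroʳ ∣ x - y ∣))
  expSum-lipschitz x y B x≤B y≤B (suc n) = begin
    ∣ (Sx + tx) - (Sy + ty) ∣                           ≡⟨ cong ∣_∣ (+-diff Sx tx Sy ty) ⟩
    ∣ (Sx - Sy) + (tx - ty) ∣                           ≤⟨ ∣p+q∣≤∣p∣+∣q∣ (Sx - Sy) (tx - ty) ⟩
    ∣ Sx - Sy ∣ + ∣ tx - ty ∣                           ≤⟨ +-mono-≤ {∣ Sx - Sy ∣} {∣ x - y ∣ * expSum B n} {∣ tx - ty ∣} {∣ x - y ∣ * expTerm B n}
                                                             (expSum-lipschitz x y B x≤B y≤B n) (expTerm-lipschitz x y B x≤B y≤B n) ⟩
    ∣ x - y ∣ * expSum B n + ∣ x - y ∣ * expTerm B n    ≡⟨ *-distribˡ-+ ∣ x - y ∣ (expSum B n) (expTerm B n) ⟨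
    ∣ x - y ∣ * (expSum B n + expTerm B n)              ∎
    where
    Sx = expSum x (suc n)
    Sy = expSum y (suc n)
    tx = expTerm x (suc n)
    ty = expTerm y (suc n)

  expSum-tail : ∀ x B → ∣ x ∣ ≤ B → ∀ m j → ∣ expSum x m - expSum x (j ℕ.+ m) ∣ + expSum B m ≤ expSum B (j ℕ.+ m)
  expSum-tail x B x≤B m zero    = ≤-reflexive (trans (cong (λ d → ∣ d ∣ + expSum B m) (+-inverseʳ (expSum x m))) (+-identityˡ (expSum B m)))
  expSum-tail x B x≤B m (suc j) = begin
    ∣ S - (S′ + t) ∣ + b          ≡⟨ cong (λ d → ∣ d ∣ + b) (regroup S S′ t) ⟩
    ∣ (S - S′) - t ∣ + b          ≤⟨ +-monoˡ-≤ b (∣p-q∣≤∣p∣+∣q∣ (S - S′) t) ⟩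
    (∣ S - S′ ∣ + ∣ t ∣) + b      ≡⟨ reorder ∣ S - S′ ∣ ∣ t ∣ b ⟩
    (∣ S - S′ ∣ + b) + ∣ t ∣      ≤⟨ +-mono-≤ {∣ S - S′ ∣ + b} {expSum B (j ℕ.+ m)} {∣ t ∣} {expTerm B (j ℕ.+ m)}
                                       (expSum-tail x B x≤B m j) (∣expTerm∣≤ x B x≤B (j ℕ.+ m)) ⟩
    expSum B (j ℕ.+ m) + expTerm B (j ℕ.+ m) ∎
    where
    S = expSum x m
    S′ = expSum x (j ℕ.+ m)
    t = expTerm x (j ℕ.+ m)
    b = expSum B m
    regroup : ∀ p q r → p - (q + r) ≡ (p - q) - r
    regroup = solve 3 (λ p q r → p :- (q :+ r) := (p :- q) :- r) refl
    reorder : ∀ p q r → (p + q) + r ≡ (p + r) + q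
    reorder = solve 3 (λ p q r → (p :+ q) :+ r := (p :+ r) :+ q) refl

  module ExpTail (B : ℚ) (0≤B : 0ℚ ≤ B) (K : ℕ) (large : ∀ k → K ℕ.≤ k → B < ι (suc k) * ½) where

    halving : ∀ k → K ℕ.≤ k → expTerm B (suc k) ≤ ½ * expTerm B k
    halving k K≤k = *-cancelˡ-≤ (ι (suc k)) {expTerm B (suc k)} {½ * expTerm B k} (0<ι-suc k) (begin
      ι (suc k) * expTerm B (suc k)   ≡⟨ expTerm-suc B k ⟩
      B * expTerm B k                 ≤⟨ *-monoʳ {B} {ι (suc k) * ½} (expTerm B k) (0≤expTerm B 0≤B k) (<⇒≤ (large k K≤k)) ⟩
      ι (suc k) * ½ * expTerm B k     ≡⟨ *-assoc (ι (suc k)) ½ (expTerm B k) ⟩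
      ι (suc k) * (½ * expTerm B k)   ∎)

    majorant : ℕ → ℚ
    majorant k = expSum B k + (expTerm B k + expTerm B k)

    majorant-anti : ∀ m → K ℕ.≤ m → ∀ j → majorant (j ℕ.+ m) ≤ majorant m
    majorant-anti m K≤m zero    = ≤-refl
    majorant-anti m K≤m (suc j) = begin
      S + t + (t′ + t′)           ≤⟨ +-monoʳ-≤ (S + t) (+-mono-≤ {t′} {½ * t} {t′} {½ * t} t′≤½t t′≤½t) ⟩
      S + t + (½ * t + ½ * t)     ≡⟨ cong (_+_ (S + t)) (½*ε+½*ε t) ⟩
      S + t + t                   ≡⟨ +-assoc S t t ⟩
      majorant (j ℕ.+ m)          ≤⟨ majorant-anti m K≤m j ⟩
      majorant m                  ∎
      where
      S = expSum B (j ℕ.+ m)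
      t = expTerm B (j ℕ.+ m)
      t′ = expTerm B (suc (j ℕ.+ m))
      t′≤½t = halving (j ℕ.+ m) (ℕₚ.≤-trans K≤m (ℕₚ.m≤n+m m j))

    expSum≤majorant : ∀ m → K ℕ.≤ m → ∀ j → expSum B (j ℕ.+ m) ≤ majorant m
    expSum≤majorant m K≤m j = ≤-trans
      (p≤p+q {expSum B (j ℕ.+ m)} {t + t} (≤-trans (≤-reflexive (sym (+-identityˡ 0ℚ))) (+-mono-≤ {0ℚ} {t} {0ℚ} {t} 0≤t 0≤t)))
      (majorant-anti m K≤m j)
      where
      t = expTerm B (j ℕ.+ m)
      0≤t = 0≤expTerm B 0≤B (j ℕ.+ m)

    tail≤ : ∀ x → ∣ x ∣ ≤ B → ∀ m → K ℕ.≤ m → ∀ j → ∣ expSum x m - expSum x (j ℕ.+ m) ∣ ≤ expTerm B m + expTerm B m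
    tail≤ x x≤B m K≤m j = begin
      d             ≡⟨ insert d S ⟩
      d + S - S     ≤⟨ +-monoˡ-≤ (- S) (≤-trans (expSum-tail x B x≤B m j) (expSum≤majorant m K≤m j)) ⟩
      S + 2t - S    ≡⟨ remove S 2t ⟩
      2t            ∎
      where
      d = ∣ expSum x m - expSum x (j ℕ.+ m) ∣
      S = expSum B m
      2t = expTerm B m + expTerm B m
      insert : ∀ p q → p ≡ p + q - q
      insert = solve 2 (λ p q → p := p :+ q :- q) refl
      remove : ∀ p q → p + q - p ≡ q
      remove = solve 2 (λ p q → p :+ q :- p := q) refl

    term≤ : ∀ j → expTerm B (j ℕ.+ K) ≤ expTerm B K
    term≤ zero    = ≤-refl
    term≤ (suc j) = begin
      expTerm B (suc (j ℕ.+ K)) ≤⟨ halving (j ℕ.+ K) (ℕₚ.m≤n+m K j) ⟩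
      ½ * t                     ≡⟨ +-identityʳ (½ * t) ⟨
      ½ * t + 0ℚ                ≤⟨ +-monoʳ-≤ (½ * t) (*-mono-0≤ {½} {t} (<⇒≤ (positive⁻¹ ½)) (0≤expTerm B 0≤B (j ℕ.+ K))) ⟩
      ½ * t + ½ * t             ≡⟨ ½*ε+½*ε t ⟩
      t                         ≤⟨ term≤ j ⟩
      expTerm B K               ∎
      where t = expTerm B (j ℕ.+ K)

    term-small : ∀ η → 0ℚ < η → ∃[ L ] ∀ k → L ℕ.≤ k → expTerm B k < η
    term-small η 0<η =
      let L , big = ι-unbounded {η} {B * expTerm B K} 0<η
      in suc (L ℕ.⊔ K) , λ { (suc k) (ℕ.s≤s k≥) → *-cancelˡ-< (ι (suc k)) {expTerm B (suc k)} {η} (0<ι-suc k) (begin-strict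
        ι (suc k) * expTerm B (suc k) ≡⟨ expTerm-suc B k ⟩
        B * expTerm B k               ≤⟨ *-monoˡ {expTerm B k} {expTerm B K} B 0≤B (decay k (ℕₚ.m⊔n≤o⇒n≤o L K k≥)) ⟩
        B * expTerm B K               <⟨ big k (ℕₚ.m⊔n≤o⇒m≤o L K k≥) ⟩
        ι (suc k) * η                 ∎) }
      where
      decay : ∀ k → K ℕ.≤ k → expTerm B k ≤ expTerm B K
      decay k K≤k = subst (λ i → expTerm B i ≤ expTerm B K) (ℕₚ.m∸n+n≡m K≤k) (term≤ (k ℕ.∸ K))

    bound : ℚ
    bound = majorant K + 1ℚ

    0<bound : 0ℚ < bound
    0<bound = <-≤-trans 0<1 (≤-trans (≤-reflexive (sym (+-identityˡ 1ℚ)))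
      (+-monoˡ-≤ 1ℚ (≤-trans (0≤expSum K) (expSum≤majorant K ℕₚ.≤-refl 0))))
      where
      0≤expSum : ∀ n → 0ℚ ≤ expSum B n
      0≤expSum zero    = ≤-refl
      0≤expSum (suc n) = ≤-trans (0≤expSum n) (p≤p+q {expSum B n} {expTerm B n} (0≤expTerm B 0≤B n))

    close : ∀ x y m → ∣ x ∣ ≤ B → ∣ y ∣ ≤ B → suc K ℕ.≤ m → ∀ j →
            ∣ expSum x m - expSum y (j ℕ.+ m) ∣ ≤ bound * ∣ x - y ∣ + (expTerm B m + expTerm B m)
    close x y (suc m) x≤B y≤B (ℕ.s≤s K≤m) j = ≤-trans
      (∣-∣-triangle (expSum x (suc m)) (expSum y (suc m)) (expSum y (j ℕ.+ suc m)))
      (+-mono-≤ {∣ expSum x (suc m) - expSum y (suc m) ∣} {bound * ∣ x - y ∣}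
        (begin
          ∣ expSum x (suc m) - expSum y (suc m) ∣   ≤⟨ expSum-lipschitz x y B x≤B y≤B m ⟩
          ∣ x - y ∣ * expSum B m                    ≡⟨ *-comm ∣ x - y ∣ (expSum B m) ⟩
          expSum B m * ∣ x - y ∣                    ≤⟨ *-monoʳ {expSum B m} {bound} ∣ x - y ∣ (0≤∣p∣ (x - y)) (≤-trans expSum≤ (p≤p+q {majorant K} {1ℚ} (<⇒≤ 0<1))) ⟩
          bound * ∣ x - y ∣                         ∎)
        (tail≤ y y≤B (suc m) (ℕₚ.m≤n⇒m≤1+n K≤m) j))
      where
      expSum≤ : expSum B m ≤ majorant K
      expSum≤ = subst (λ i → expSum B i ≤ majorant K) (ℕₚ.m∸n+n≡m K≤m) (expSum≤majorant K ℕₚ.≤-refl (m ℕ.∸ K))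

  expSum-isCauchy : ∀ {s} → IsCauchy s → IsCauchy (λ n → expSum (s n) n)
  expSum-isCauchy {s} s-cauchy ε 0<ε =
    let B , 0<B , M , s≤B = eventually-bounded {s} s-cauchy
        K , large = ι-unbounded {½} {B} (positive⁻¹ ½)
    in within B (<⇒≤ 0<B) M s≤B K large
    where
    within : ∀ B → 0ℚ ≤ B → ∀ M → (∀ n → M ℕ.≤ n → ∣ s n ∣ ≤ B) → ∀ K → (∀ k → K ℕ.≤ k → B < ι (suc k) * ½) →
             ∃[ N ] ∀ m n → N ℕ.≤ m → N ℕ.≤ n → ∣ expSum (s m) m - expSum (s n) n ∣ < ε
    within B 0≤B M s≤B K large =
      let δ , 0<δ , bδ≡ = divide bound (½ * ε) 0<bound (0<½*ε ε 0<ε)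
          L , sL = s-cauchy δ 0<δ
          P , tP = term-small (½ * (½ * ε)) (0<½*ε (½ * ε) (0<½*ε ε 0<ε))
          N = (M ℕ.⊔ suc K) ℕ.⊔ (L ℕ.⊔ P)
          M≤ : ∀ {n} → N ℕ.≤ n → M ℕ.≤ n
          M≤ n≥ = ℕₚ.m⊔n≤o⇒m≤o M (suc K) (ℕₚ.m⊔n≤o⇒m≤o (M ℕ.⊔ suc K) (L ℕ.⊔ P) n≥)
          K≤ : ∀ {n} → N ℕ.≤ n → suc K ℕ.≤ n
          K≤ n≥ = ℕₚ.m⊔n≤o⇒n≤o M (suc K) (ℕₚ.m⊔n≤o⇒m≤o (M ℕ.⊔ suc K) (L ℕ.⊔ P) n≥)
          L≤ : ∀ {n} → N ℕ.≤ n → L ℕ.≤ n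
          L≤ n≥ = ℕₚ.m⊔n≤o⇒m≤o L P (ℕₚ.m⊔n≤o⇒n≤o (M ℕ.⊔ suc K) (L ℕ.⊔ P) n≥)
          P≤ : ∀ {n} → N ℕ.≤ n → P ℕ.≤ n
          P≤ n≥ = ℕₚ.m⊔n≤o⇒n≤o L P (ℕₚ.m⊔n≤o⇒n≤o (M ℕ.⊔ suc K) (L ℕ.⊔ P) n≥)
          ordered : ∀ m j → N ℕ.≤ m → N ℕ.≤ j ℕ.+ m → ∣ expSum (s m) m - expSum (s (j ℕ.+ m)) (j ℕ.+ m) ∣ < ε
          ordered m j m≥ n≥ = ≤-<-trans
            (close (s m) (s (j ℕ.+ m)) m (s≤B m (M≤ m≥)) (s≤B (j ℕ.+ m) (M≤ n≥)) (K≤ m≥) j)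
            (subst (bound * ∣ s m - s (j ℕ.+ m) ∣ + (expTerm B m + expTerm B m) <_)
              (trans (cong₂ _+_ bδ≡ (½*ε+½*ε (½ * ε))) (½*ε+½*ε ε))
              (+-mono-< {bound * ∣ s m - s (j ℕ.+ m) ∣} {bound * δ} {expTerm B m + expTerm B m} {½ * (½ * ε) + ½ * (½ * ε)}
                (*-monoʳ-<-pos bound {{positive 0<bound}} (sL m (j ℕ.+ m) (L≤ m≥) (L≤ n≥)))
                (+-mono-< {expTerm B m} {½ * (½ * ε)} {expTerm B m} {½ * (½ * ε)} (tP m (P≤ m≥)) (tP m (P≤ m≥)))))
          sorted : ∀ m n → m ℕ.≤ n → N ℕ.≤ m → N ℕ.≤ n → ∣ expSum (s m) m - expSum (s n) n ∣ < ε
          sorted m n m≤n m≥ n≥ = subst (λ i → ∣ expSum (s m) m - expSum (s i) i ∣ < ε) (ℕₚ.m∸n+n≡m m≤n)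
            (ordered m (n ℕ.∸ m) m≥ (subst (N ℕ.≤_) (sym (ℕₚ.m∸n+n≡m m≤n)) n≥))
      in N , λ m n m≥ n≥ → either m n (ℕₚ.≤-total m n) (λ m≤n → sorted m n m≤n m≥ n≥) (λ n≤m → sorted n m n≤m n≥ m≥)
      where
      open ExpTail B 0≤B K large
      either : ∀ m n → m ℕ.≤ n ⊎ n ℕ.≤ m →
               (m ℕ.≤ n → ∣ expSum (s m) m - expSum (s n) n ∣ < ε) →
               (n ℕ.≤ m → ∣ expSum (s n) n - expSum (s m) m ∣ < ε) →
               ∣ expSum (s m) m - expSum (s n) n ∣ < ε
      either m n (inj₁ m≤n) f g = f m≤n
      either m n (inj₂ n≤m) f g = subst (_< ε) (∣-∣-comm (expSum (s n) n) (expSum (s m) m)) (g n≤m)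

  PositiveTail : (ℕ → ℤ) → Set
  PositiveTail a = ∀ i → 0ℤ ℤ.< a (suc i)

  Positive-all : (ℕ → ℤ) → Set
  Positive-all a = ∀ i → 0ℤ ℤ.< a i

  1≤quotient : ∀ {i} → 0ℤ ℤ.< i → 1ℚ ≤ i / 1
  1≤quotient {i} 0<i = /1-mono {1ℤ} {i} (ℤₚ.i<j⇒suc[i]≤j 0<i)

  1≤convergent : ∀ {a} → Positive-all a → ∀ n → 1ℚ ≤ convergent a n
  1≤convergent {a} a>0 zero    = 1≤quotient (a>0 0)
  1≤convergent {a} a>0 (suc n) = ≤-trans (1≤quotient (a>0 0))
    (p≤p+q {a 0 / 1} {inv c} (<⇒≤ (inv-0< {c} (<-≤-trans 0<1 (1≤convergent (a>0 ∘ suc) n)))))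
    where c = convergent (a ∘ suc) n

  a₀≤convergent : ∀ {a} → PositiveTail a → ∀ n → a 0 / 1 ≤ convergent a n
  a₀≤convergent {a} a>0 zero    = ≤-refl
  a₀≤convergent {a} a>0 (suc n) = p≤p+q {a 0 / 1} {inv c} (<⇒≤ (inv-0< {c} (<-≤-trans 0<1 (1≤convergent a>0 n))))
    where c = convergent (a ∘ suc) n

  convergent≤a₀+1 : ∀ {a} → PositiveTail a → ∀ n → convergent a n ≤ a 0 / 1 + 1ℚ
  convergent≤a₀+1 {a} a>0 zero    = p≤p+q {a 0 / 1} {1ℚ} (<⇒≤ 0<1)
  convergent≤a₀+1 {a} a>0 (suc n) = +-monoʳ-≤ (a 0 / 1) {inv (convergent (a ∘ suc) n)} {1ℚ}
    (inv-antimono {1ℚ} {convergent (a ∘ suc) n} 0<1 (1≤convergent a>0 n))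

  module TwoSteps (a₁ : ℚ) (1≤a₁ : 1ℚ ≤ a₁) where

    denominator : ℚ → ℚ
    denominator u = a₁ + inv u

    module _ (u : ℚ) (1≤u : 1ℚ ≤ u) where
      0<u : 0ℚ < u
      0<u = <-≤-trans 0<1 1≤u

      0<denominator : 0ℚ < denominator u
      0<denominator = <-≤-trans 0<1 (≤-trans 1≤a₁ (p≤p+q {a₁} {inv u} (<⇒≤ (inv-0< {u} 0<u))))

      2≤u*denominator : 1ℚ + 1ℚ ≤ u * denominator u
      2≤u*denominator = begin
        1ℚ + 1ℚ               ≤⟨ +-monoˡ-≤ 1ℚ (*-mono {1ℚ} {u} {1ℚ} {a₁} (<⇒≤ 0<1) (<⇒≤ 0<u) 1≤u 1≤a₁) ⟩
        u * a₁ + 1ℚ           ≡⟨ cong (_+_ (u * a₁)) (*-inv u (0<⇒≢0 0<u)) ⟨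
        u * a₁ + u * inv u    ≡⟨ *-distribˡ-+ u a₁ (inv u) ⟨
        u * denominator u     ∎

    contraction : ∀ a₀ u v → 1ℚ ≤ u → 1ℚ ≤ v →
                  (1ℚ + 1ℚ) * (1ℚ + 1ℚ) * ∣ (a₀ + inv (denominator u)) - (a₀ + inv (denominator v)) ∣ ≤ ∣ u - v ∣
    contraction a₀ u v 1≤u 1≤v = begin
      2ℚ * 2ℚ * ∣ (a₀ + inv w) - (a₀ + inv z) ∣   ≡⟨ cong (λ e → 2ℚ * 2ℚ * ∣ e ∣) (cancel a₀ (inv w) (inv z)) ⟩
      2ℚ * 2ℚ * ∣ d ∣                             ≤⟨ *-monoʳ {2ℚ * 2ℚ} {u * w * (v * z)} ∣ d ∣ (0≤∣p∣ d)
                                                       (*-mono {2ℚ} {u * w} {2ℚ} {v * z} 0≤2 (≤-trans 0≤2 (2≤u*denominator u 1≤u)) (2≤u*denominator u 1≤u) (2≤u*denominator v 1≤v)) ⟩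
      u * w * (v * z) * ∣ d ∣                     ≡⟨ cong (_* ∣ d ∣) (0≤p⇒∣p∣≡p 0≤uwvz) ⟨
      ∣ u * w * (v * z) ∣ * ∣ d ∣                 ≡⟨ ∣p*q∣≡∣p∣*∣q∣ (u * w * (v * z)) d ⟨
      ∣ u * w * (v * z) * d ∣                     ≡⟨ cong ∣_∣ uwvzd≡ ⟩
      ∣ u - v ∣                                   ∎
      where
      2ℚ = 1ℚ + 1ℚ
      0≤2 : 0ℚ ≤ 2ℚ
      0≤2 = <⇒≤ (positive⁻¹ 2ℚ)
      w = denominator u
      z = denominator v
      d = inv w - inv z
      0≤uwvz : 0ℚ ≤ u * w * (v * z)
      0≤uwvz = *-mono-0≤ {u * w} {v * z} (≤-trans 0≤2 (2≤u*denominator u 1≤u)) (≤-trans 0≤2 (2≤u*denominator v 1≤v))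
      cancel : ∀ a p q → (a + p) - (a + q) ≡ p - q
      cancel = solve 3 (λ a p q → (a :+ p) :- (a :+ q) := p :- q) refl
      regroup : ∀ u w v z d → u * w * (v * z) * d ≡ u * v * (w * z * d)
      regroup = solve 5 (λ u w v z d → u :* w :* (v :* z) :* d := u :* v :* (w :* z :* d)) refl
      flip : ∀ u v p q → u * v * (q - p) ≡ - (u * v * (p - q))
      flip = solve 4 (λ u v p q → u :* v :* (q :- p) := :- (u :* v :* (p :- q))) refl
      neg-diff : ∀ u v → - (v - u) ≡ u - v
      neg-diff = solve 2 (λ u v → :- (v :- u) := u :- v) refl
      uwvzd≡ : u * w * (v * z) * d ≡ u - v
      uwvzd≡ = begin-equality
        u * w * (v * z) * d                       ≡⟨ regroup u w v z d ⟩
        u * v * (w * z * d)                       ≡⟨ cong (u * v *_) (inv-diff w z (0<⇒≢0 (0<denominator u 1≤u)) (0<⇒≢0 (0<denominator v 1≤v))) ⟩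
        u * v * (z - w)                           ≡⟨ cong (u * v *_) (cancel a₁ (inv v) (inv u)) ⟩
        u * v * (inv v - inv u)                   ≡⟨ flip u v (inv u) (inv v) ⟩
        - (u * v * (inv u - inv v))               ≡⟨ cong -_ (inv-diff u v (0<⇒≢0 (0<u u 1≤u)) (0<⇒≢0 (0<u v 1≤v))) ⟩
        - (v - u)                                 ≡⟨ neg-diff u v ⟩
        u - v                                     ∎

  oscillation : ∀ k {a} → PositiveTail a → ∀ m n →
                ι (suc k) * ∣ convergent a (k ℕ.+ k ℕ.+ m) - convergent a (k ℕ.+ k ℕ.+ n) ∣ ≤ 1ℚ
  oscillation zero {a} a>0 m n = ≤-trans (≤-reflexive (*-identityˡ ∣ convergent a m - convergent a n ∣))
    (∣-∣≤ {convergent a m} {convergent a n} {1ℚ} (near m n) (near n m))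
    where
    near : ∀ m n → convergent a m ≤ convergent a n + 1ℚ
    near m n = ≤-trans (convergent≤a₀+1 a>0 m) (+-monoˡ-≤ 1ℚ (a₀≤convergent a>0 n))
  oscillation (suc k) {a} a>0 m n = subst (λ i → ι (2 ℕ.+ k) * ∣ convergent a (suc (i ℕ.+ m)) - convergent a (suc (i ℕ.+ n)) ∣ ≤ 1ℚ)
    (sym (ℕₚ.+-suc k k)) (begin
      ι (2 ℕ.+ k) * e               ≤⟨ *-monoʳ {ι (2 ℕ.+ k)} {ι (suc k) * 4ℚ} e (0≤∣p∣ (c m - c n)) ι≤ ⟩
      ι (suc k) * 4ℚ * e            ≡⟨ *-assoc (ι (suc k)) 4ℚ e ⟩
      ι (suc k) * (4ℚ * e)          ≤⟨ *-monoˡ {4ℚ * e} {∣ u m - u n ∣} (ι (suc k)) (0≤ι (suc k))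
                                         (TwoSteps.contraction (a 1 / 1) (1≤quotient (a>0 0)) (a 0 / 1) (u m) (u n)
                                           (1≤convergent (a>0 ∘ suc) (k ℕ.+ k ℕ.+ m)) (1≤convergent (a>0 ∘ suc) (k ℕ.+ k ℕ.+ n))) ⟩
      ι (suc k) * ∣ u m - u n ∣     ≤⟨ oscillation k (a>0 ∘ suc ∘ suc) m n ⟩
      1ℚ                            ∎)
    where
    4ℚ = (1ℚ + 1ℚ) * (1ℚ + 1ℚ)
    c : ℕ → ℚ
    c i = convergent a (2 ℕ.+ (k ℕ.+ k ℕ.+ i))
    u : ℕ → ℚ
    u i = convergent (a ∘ suc ∘ suc) (k ℕ.+ k ℕ.+ i)
    e = ∣ c m - c n ∣
    ι≤ : ι (2 ℕ.+ k) ≤ ι (suc k) * 4ℚ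
    ι≤ = begin
      ι (2 ℕ.+ k)                             ≡⟨ ι-suc (suc k) ⟩
      1ℚ + ι (suc k)                          ≤⟨ +-monoˡ-≤ (ι (suc k)) (/1-mono {1ℤ} {+ suc k} (ℤ.+≤+ (ℕ.s≤s ℕ.z≤n))) ⟩
      ι (suc k) + ι (suc k)                   ≤⟨ p≤p+q {ι (suc k) + ι (suc k)} {ι (suc k) + ι (suc k)}
                                                   (≤-trans (≤-reflexive (sym (+-identityˡ 0ℚ))) (+-mono-≤ {0ℚ} {ι (suc k)} {0ℚ} {ι (suc k)} (0≤ι (suc k)) (0≤ι (suc k)))) ⟩
      ι (suc k) + ι (suc k) + (ι (suc k) + ι (suc k)) ≡⟨ quadruple (ι (suc k)) ⟩
      ι (suc k) * 4ℚ                          ∎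
      where
      quadruple : ∀ p → p + p + (p + p) ≡ p * 4ℚ
      quadruple = solve 1 (λ p → p :+ p :+ (p :+ p) := p :* con 4ℚ) refl

  convergent-isCauchy : ∀ {a} → PositiveTail a → IsCauchy (convergent a)
  convergent-isCauchy {a} a>0 ε 0<ε =
    let k , big = ι-unbounded {ε} {1ℚ} 0<ε
        close : ∀ m n → ∣ convergent a (k ℕ.+ k ℕ.+ m) - convergent a (k ℕ.+ k ℕ.+ n) ∣ < ε
        close m n = *-cancelˡ-< (ι (suc k)) {∣ convergent a (k ℕ.+ k ℕ.+ m) - convergent a (k ℕ.+ k ℕ.+ n) ∣} {ε} (0<ι-suc k)
          (≤-<-trans (oscillation k a>0 m n) (big k ℕₚ.≤-refl))
    in k ℕ.+ k , λ m n m≥ n≥ → subst₂ (λ i j → ∣ convergent a i - convergent a j ∣ < ε)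
      (ℕₚ.m+[n∸m]≡n m≥) (ℕₚ.m+[n∸m]≡n n≥) (close (m ℕ.∸ (k ℕ.+ k)) (n ℕ.∸ (k ℕ.+ k)))

  convergent-bounded-away : ∀ {a} → PositiveTail a → 0ℤ ℤ.≤ a 0 → BoundedAwayFrom0 (convergent a)
  convergent-bounded-away {a} a>0 0≤a₀ = inv K , inv-0< {K} 0<K , 1 , λ { (suc n) _ → bound n }
    where
    K = a 1 / 1 + 1ℚ
    0<K : 0ℚ < K
    0<K = <-≤-trans 0<1 (≤-trans (1≤quotient (a>0 0)) (p≤p+q {a 1 / 1} {1ℚ} (<⇒≤ 0<1)))
    bound : ∀ n → inv K ≤ ∣ convergent a (suc n) ∣
    bound n = begin
      inv K                       ≤⟨ inv-antimono {c} {K} (<-≤-trans 0<1 (1≤convergent a>0 n)) (convergent≤a₀+1 (a>0 ∘ suc) n) ⟩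
      inv c                       ≡⟨ +-identityˡ (inv c) ⟨
      0ℚ + inv c                  ≤⟨ +-monoˡ-≤ (inv c) (/1-mono {0ℤ} {a 0} 0≤a₀) ⟩
      a 0 / 1 + inv c             ≡⟨ 0≤p⇒∣p∣≡p 0≤cₙ₊₁ ⟨
      ∣ a 0 / 1 + inv c ∣         ∎
      where
      c = convergent (a ∘ suc) n
      0≤cₙ₊₁ : 0ℚ ≤ a 0 / 1 + inv c
      0≤cₙ₊₁ = ≤-trans (/1-mono {0ℤ} {a 0} 0≤a₀) (a₀≤convergent {a} a>0 (suc n))

open RationalSequences
  using (IsCauchy; BoundedAwayFrom0; inv; expSum; convergent; const-isCauchy; +-isCauchy; neg-isCauchy;
         *-isCauchy; inv-isCauchy; expSum-isCauchy; convergent-isCauchy; convergent-bounded-away)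

-- Cauchy sequences of rationals; equality of real numbers is _≈_.

record ℝ : Set where
  constructor mkℝ
  field
    seq      : ℕ → ℚ
    isCauchy : IsCauchy seq

open ℝ public

infix  4 _≈_ _<_ _≤_
infixl 6 _+_ _-_
infixl 7 _*_
infix  8 -_
infix  9 _⁻¹⟨_⟩

_≈_ : ℝ → ℝ → Set
x ≈ y = ∀ ε → 0ℚ ℚ.< ε → ∃[ N ] ∀ n → N ℕ.≤ n → ℚ.∣ seq x n ℚ.- seq y n ∣ ℚ.< ε

_<_ : ℝ → ℝ → Set
x < y = ∃[ ε ] 0ℚ ℚ.< ε × ∃[ N ] ∀ n → N ℕ.≤ n → seq x n ℚ.+ ε ℚ.≤ seq y n

_≤_ : ℝ → ℝ → Set
x ≤ y = ∀ ε → 0ℚ ℚ.< ε → ∃[ N ] ∀ n → N ℕ.≤ n → seq x n ℚ.≤ seq y n ℚ.+ ε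

fromℚ : ℚ → ℝ
fromℚ q = mkℝ (λ _ → q) (const-isCauchy q)

fromℤ : ℤ → ℝ
fromℤ i = fromℚ (i / 1)

fromℕ : ℕ → ℝ
fromℕ n = fromℤ (+ n)

_+_ : ℝ → ℝ → ℝ
x + y = mkℝ (λ n → seq x n ℚ.+ seq y n) (+-isCauchy {seq x} {seq y} (isCauchy x) (isCauchy y))

-_ : ℝ → ℝ
- x = mkℝ (λ n → ℚ.- seq x n) (neg-isCauchy {seq x} (isCauchy x))

_-_ : ℝ → ℝ → ℝ
x - y = x + - y

_*_ : ℝ → ℝ → ℝ
x * y = mkℝ (λ n → seq x n ℚ.* seq y n) (*-isCauchy {seq x} {seq y} (isCauchy x) (isCauchy y))

-- Constructive nonzeroness; classically this is ¬ (x ≈ 0).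
_#0 : ℝ → Set
x #0 = BoundedAwayFrom0 (seq x)

_⁻¹⟨_⟩ : (x : ℝ) → x #0 → ℝ
x ⁻¹⟨ x#0 ⟩ = mkℝ (λ n → inv (seq x n)) (inv-isCauchy {seq x} (isCauchy x) x#0)

-- exp x = ∑ xᵏ / k!, along the diagonal n ↦ ∑_{k < n} xₙᵏ / k!
exp : ℝ → ℝ
exp x = mkℝ (λ n → expSum (seq x n) n) (expSum-isCauchy {seq x} (isCauchy x))

-- log, real powers θ ^ y = exp (y * log θ), √ and ⌊_⌋ are given by their
-- graphs, which are single-valued up to _≈_; the floor is not a total function
-- constructively.

IsLog : ℝ → ℝ → Set
IsLog θ y = exp y ≈ θ

IsPower : ℝ → ℝ → ℝ → Set
IsPower θ y z = ∃[ logθ ] IsLog θ logθ × z ≈ exp (y * logθ)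

Is√ : ℝ → ℝ → Set
Is√ x y = fromℕ 0 ≤ y × y * y ≈ x

IsFloor : ℝ → ℤ → Set
IsFloor x m = fromℤ m ≤ x × x < fromℤ (m ℤ.+ 1ℤ)

record ContinuedFraction : Set where
  field
    quotient : ℕ → ℤ
    positive : ∀ i → 0ℤ ℤ.< quotient (suc i)

open ContinuedFraction public

value : ContinuedFraction → ℝ
value a = mkℝ (convergent (quotient a)) (convergent-isCauchy {quotient a} (positive a))

value#0 : (a : ContinuedFraction) → quotient a 0 ≡ 0ℤ → value a #0
value#0 a a₀≡0 = convergent-bounded-away {quotient a} (positive a) (ℤₚ.≤-reflexive (sym a₀≡0))

-- m = ⌊ 1 / (θ ^ (1 / n) - 1) ⌋
IsM′ : ℝ → (n : ℕ) .{{_ : NonZero n}} → ℤ → Set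
IsM′ θ n m = ∃[ r ] IsPower θ (fromℚ (+ 1 / n)) r ×
  Σ[ r-1#0 ∈ (r - fromℕ 1) #0 ] IsFloor ((r - fromℕ 1) ⁻¹⟨ r-1#0 ⟩) m

-- m = ⌊ n / log θ - 1 / 2 ⌋
IsApproximation : ℝ → ℕ → ℤ → Set
IsApproximation θ n m = ∃[ logθ ] IsLog θ logθ ×
  Σ[ logθ#0 ∈ logθ #0 ] IsFloor (fromℕ n * logθ ⁻¹⟨ logθ#0 ⟩ - fromℚ ½) m

-- Intended for θ > 1.  Both floors must exist and differ.
𝒜 : ℝ → ℕ → Set
𝒜 θ n = Σ[ n≢0 ∈ NonZero n ] ∃[ m ] ∃[ m′ ]
  IsM′ θ n {{n≢0}} m × IsApproximation θ n m′ × m ≢ m′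

-- Unboundedness, the constructively stronger form of "not finite".
Infinite : (ℕ → Set) → Set
Infinite P = ∀ N → ∃[ n ] N ℕ.≤ n × P n

-- Put y = log θ, ℓ = 2 / y and x = y / n.  Since 1 / (eˣ − 1) = 1 / x − 1 / 2 + x / 12 − …,
-- the two floors are m and m − 1 as soon as p = 2 m + 1 satisfies
-- 0 < p − n ℓ < x / 6 with some room to spare.  A convergent p / n of ℓ that exceeds ℓ and
-- is followed by a partial quotient 4 has p − n ℓ ≤ 1 / (4 n) = x ℓ / 8 ≤ x / 16, and the
-- quotients 0, 2, 4, ∗, 4, ∗, … make the numerators of all these convergents odd.
-- For y = 4 − c + √(c (c + 1)) the same p and n come from a Pell recurrence.

module Submission where

open import Data.Integer using (ℤ; +_; 0ℤ)
import Data.Integer as ℤ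
import Data.Integer.Properties as ℤₚ
open import Data.Nat using (ℕ; suc; zero; NonZero) renaming (_+_ to _+ℕ_; _*_ to _*ℕ_; _≤_ to _≤ℕ_)
import Data.Nat as ℕ
import Data.Nat.Properties as ℕₚ
open import Data.Product using (_×_; _,_; ∃-syntax; Σ-syntax)
open import Data.Rational using (ℚ; 0ℚ; 1ℚ; ½; _/_)
import Data.Rational as ℚ
import Data.Rational.Properties as ℚₚ
open import Data.Sum using (inj₁; inj₂)
open import Function using (_∘_)
open import Relation.Binary.PropositionalEquality using (_≡_; refl; sym; trans; cong; cong₂; subst; subst₂)
import Defs

-- Both floor conditions are settled termwise on rationals: `exp` at index `k` is a sum of `k` terms
-- at the `k`-th approximation of its argument, and a finite convergent is the same Möbius image of
-- its truncated tail as the limit is of the full tail. The obstacle is uniformity. A strict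
-- inequality between reals needs one separation valid along a whole tail of the sequence, so each
-- family must bound the excess p y - 2 n below by a constant fixed before `y`: for the continued
-- fraction because the truncated tails stay between 4 and 5, for the radical because the norm has
-- absolute value c ≥ 1 and its perturbation is kept within 1 / 4. The threshold x / 6 is replaced
-- by x / 8. This pays for bounding (eˣ - 1) / x by 1 + x / 2 + 3 x² / 16, with 3 / 16 in place of 1
-- / 6: against the bound 1 - x / 2 + x² / 16 for m x the quadratic terms cancel, as 1 / 16 + 3 / 16
-- = 1 / 4, and the cubic term is negative.

module RationalEstimates where
  open Defs.RationalSequences
  open import Data.Rational using (_+_; _*_; _-_; -_; _≤_; _<_; *<*; ∣_∣)
  open import Data.Rational.Properties
  open import Data.Rational.Solver using (module +-*-Solver)
  open +-*-Solver using (solve; _:=_; _:+_; _:*_; _:-_; :-_; con)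
  open ≤-Reasoning

  -- Rational inequalities and bounds on exponential partial sums

  ¼ : ℚ
  ¼ = + 1 / 4

  -- Turns a polynomial inequality into a certificate: a difference `d` that is visibly nonnegative
  -- and a ring identity for the solver.
  ≤-from : ∀ p d {q} → 0ℚ ≤ d → q ≡ p + d → p ≤ q
  ≤-from p d {q} 0≤d q≡p+d = subst (p ≤_) (sym q≡p+d) (p≤p+q {p} {d} 0≤d)

  0≤q-p : ∀ {p q} → p ≤ q → 0ℚ ≤ q - p
  0≤q-p {p} {q} p≤q = subst (_≤ q - p) (+-inverseʳ p) (+-monoˡ-≤ (- p) p≤q)

  ι-mono : ∀ {m n} → m ℕ.≤ n → ι m ≤ ι n
  ι-mono {m} {n} m≤n = /1-mono {+ m} {+ n} (ℤ.+≤+ m≤n)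

  +-mono-0≤ : ∀ {p q} → 0ℚ ≤ p → 0ℚ ≤ q → 0ℚ ≤ p + q
  +-mono-0≤ {p} {q} = +-mono-≤ {0ℚ} {p} {0ℚ} {q}

  expSum-mono : ∀ x → 0ℚ ≤ x → ∀ m j → expSum x m ≤ expSum x (j ℕ.+ m)
  expSum-mono x 0≤x m zero    = ≤-refl
  expSum-mono x 0≤x m (suc j) = ≤-trans (expSum-mono x 0≤x m j)
    (p≤p+q {expSum x (j ℕ.+ m)} {expTerm x (j ℕ.+ m)} (0≤expTerm x 0≤x (j ℕ.+ m)))

  1+x≤expSum : ∀ x → 0ℚ ≤ x → ∀ {k} → 2 ℕ.≤ k → 1ℚ + x ≤ expSum x k
  1+x≤expSum x 0≤x {k} 2≤k = begin
    1ℚ + x                    ≡⟨ solve 1 (λ x → con 1ℚ :+ x := con 0ℚ :+ con 1ℚ :* con 1ℚ :+ x :* con 1ℚ :* con 1ℚ) refl x ⟩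
    expSum x 2                ≤⟨ expSum-mono x 0≤x 2 (k ℕ.∸ 2) ⟩
    expSum x (k ℕ.∸ 2 ℕ.+ 2)  ≡⟨ cong (expSum x) (ℕₚ.m∸n+n≡m 2≤k) ⟩
    expSum x k                ∎

  -- The cubic term x³ / 6 and the remainder 2 x⁴ / 24 add up to x³ (1 / 6 + x / 12), and 1 / 6 + 1
  -- / 48 = 3 / 16 is the value of the bracket at x = 1 / 4.
  expSum≤ : ∀ x → 0ℚ ≤ x → x ≤ ¼ → ∀ {k} → 4 ℕ.≤ k →
            ι 16 * (expSum x k - 1ℚ) ≤ x * (ι 16 + ι 8 * x + ι 3 * (x * x))
  expSum≤ x 0≤x x≤¼ {k} 4≤k = begin
    ι 16 * (expSum x k - 1ℚ)                  ≡⟨ cong (λ i → ι 16 * (expSum x i - 1ℚ)) (ℕₚ.m∸n+n≡m 4≤k) ⟨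
    ι 16 * (expSum x (k ℕ.∸ 4 ℕ.+ 4) - 1ℚ)    ≤⟨ *-monoˡ (ι 16) (0≤ι 16) (+-monoˡ-≤ (- 1ℚ) (expSum≤majorant 4 ℕ.z≤n (k ℕ.∸ 4))) ⟩
    ι 16 * (majorant 4 - 1ℚ)                  ≤⟨ ≤-from (ι 16 * (majorant 4 - 1ℚ)) (x * x * x * ((+ 4 / 3) * (¼ - x)))
                                                   (*-mono-0≤ {x * x * x} {(+ 4 / 3) * (¼ - x)} (*-mono-0≤ {x * x} {x} (*-mono-0≤ {x} {x} 0≤x 0≤x) 0≤x)
                                                     (*-mono-0≤ {+ 4 / 3} {¼ - x} (<⇒≤ (positive⁻¹ (+ 4 / 3))) (0≤q-p {x} {¼} x≤¼)))
                                                   (expand x) ⟩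
    x * (ι 16 + ι 8 * x + ι 3 * (x * x))      ∎
    where
    large : ∀ k → 0 ℕ.≤ k → x < ι (suc k) * ½
    large k _ = begin-strict
      x             ≤⟨ x≤¼ ⟩
      ¼             <⟨ *<* (ℤ.+<+ (ℕ.s≤s (ℕ.s≤s (ℕ.s≤s ℕ.z≤n)))) ⟩
      ι 1 * ½       ≤⟨ *-monoʳ {ι 1} {ι (suc k)} ½ (<⇒≤ (positive⁻¹ ½)) (ι-mono {1} {suc k} (ℕ.s≤s ℕ.z≤n)) ⟩
      ι (suc k) * ½ ∎
    -- The terms halve from k = 0 on, so those with k ≥ 4 add up to at most 2 x⁴ / 24.
    open ExpTail x 0≤x 0 large
    expand : ∀ x → x * (ι 16 + ι 8 * x + ι 3 * (x * x)) ≡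
      ι 16 * (expSum x 4 + (expTerm x 4 + expTerm x 4) - 1ℚ) + x * x * x * ((+ 4 / 3) * (¼ - x))
    expand = solve 1 (λ x →
      let x⁰ = con 1ℚ ; x¹ = x :* x⁰ ; x² = x :* x¹ ; x³ = x :* x² ; x⁴ = x :* x³
          t₄ = x⁴ :* con (+ 1 / 24)
      in x :* (con (ι 16) :+ con (ι 8) :* x :+ con (ι 3) :* (x :* x)) :=
         con (ι 16) :* (con 0ℚ :+ x⁰ :* con 1ℚ :+ x¹ :* con 1ℚ :+ x² :* con ½ :+ x³ :* con (+ 1 / 6) :+ (t₄ :+ t₄) :- con 1ℚ)
           :+ x :* x :* x :* (con (+ 4 / 3) :* (con ¼ :- x))) refl

  -- The two floors at a rational approximation of log θ

  ι*1/≡1 : ∀ n .{{_ : NonZero n}} → ι n * (+ 1 / n) ≡ 1ℚ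
  ι*1/≡1 n = trans (cong (ι n *_) (/-cong {+ 1} {n} {+ 1} {n ℕ.* 1} refl (sym (ℕₚ.*-identityʳ n)))) (1/!-suc n 1)
    where instance _ = ℕₚ.m*n≢0 n 1

  inv-≤ : ∀ {p q} → 0ℚ < p → 1ℚ ≤ p * q → inv p ≤ q
  inv-≤ {p} {q} 0<p 1≤pq = *-cancelˡ-≤ p 0<p (subst (_≤ p * q) (sym (*-inv p (0<⇒≢0 0<p))) 1≤pq)

  ≤-inv : ∀ {p q} → 0ℚ < p → p * q ≤ 1ℚ → q ≤ inv p
  ≤-inv {p} {q} 0<p pq≤1 = *-cancelˡ-≤ p 0<p (subst (p * q ≤_) (sym (*-inv p (0<⇒≢0 0<p))) pq≤1)

  -- In terms of x = y / n the last two fields read 2 < p x and 8 p x ≤ 16 + x²; the slack ε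
  -- must not depend on y, which will run through the terms of a Cauchy sequence.
  record Approximates (n m : ℕ) (ε y : ℚ) : Set where
    private
      ν = ι n
      p = ι 2 * ι m + 1ℚ
    field
      1≤y       : 1ℚ ≤ y
      4y≤n      : ι 4 * y ≤ ν
      2n+ε≤py   : ι 2 * ν + ε ≤ p * y
      8npy≤     : ι 8 * ν * (p * y) ≤ y * y + ι 16 * (ν * ν)

  module Scaled (n m : ℕ) .{{_ : NonZero n}} (ε y : ℚ) (0<ε : 0ℚ < ε) (appr : Approximates n m ε y) where
    open Approximates appr

    ν = ι n
    μ = ι m
    p = ι 2 * μ + 1ℚ
    x = (+ 1 / n) * y

    0<ν : 0ℚ < ν
    0<ν = <-≤-trans 0<1 (ι-mono {1} {n} (ℕ.>-nonZero⁻¹ n))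

    0<y : 0ℚ < y
    0<y = <-≤-trans 0<1 1≤y

    νx≡y : ν * x ≡ y
    νx≡y = trans (sym (*-assoc ν (+ 1 / n) y)) (trans (cong (_* y) (ι*1/≡1 n)) (*-identityˡ y))

    1/n≤x : + 1 / n ≤ x
    1/n≤x = *-cancelˡ-≤ ν 0<ν (subst₂ _≤_ (sym (ι*1/≡1 n)) (sym νx≡y) 1≤y)

    0<1/n : 0ℚ < + 1 / n
    0<1/n = *-cancelˡ-< ν 0<ν (subst₂ _<_ (sym (*-zeroʳ ν)) (sym (ι*1/≡1 n)) 0<1)

    0<x : 0ℚ < x
    0<x = <-≤-trans 0<1/n 1/n≤x

    0≤x = <⇒≤ 0<x

    x≤¼ : x ≤ ¼
    x≤¼ = *-cancelˡ-≤ ν 0<ν (begin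
      ν * x            ≡⟨ νx≡y ⟩
      y                ≡⟨ solve 1 (λ y → y := con ¼ :* (con (ι 4) :* y)) refl y ⟩
      ¼ * (ι 4 * y)    ≤⟨ *-monoˡ {ι 4 * y} {ν} ¼ (<⇒≤ (positive⁻¹ ¼)) 4y≤n ⟩
      ¼ * ν            ≡⟨ *-comm ¼ ν ⟩
      ν * ¼            ∎)

    2≤px : ι 2 ≤ p * x
    2≤px = *-cancelˡ-≤ ν 0<ν (begin
      ν * ι 2          ≡⟨ *-comm ν (ι 2) ⟩
      ι 2 * ν          ≤⟨ p≤p+q {ι 2 * ν} {ε} (<⇒≤ 0<ε) ⟩
      ι 2 * ν + ε      ≤⟨ 2n+ε≤py ⟩
      p * y            ≡⟨ cong (p *_) νx≡y ⟨
      p * (ν * x)      ≡⟨ solve 3 (λ p ν x → p :* (ν :* x) := ν :* (p :* x)) refl p ν x ⟩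
      ν * (p * x)      ∎)

    8px≤ : ι 8 * (p * x) ≤ x * x + ι 16
    8px≤ = *-cancelˡ-≤ (ν * ν) (*-mono-0< {ν} {ν} 0<ν 0<ν) (begin
      ν * ν * (ι 8 * (p * x))                 ≡⟨ solve 3 (λ p ν x → ν :* ν :* (con (ι 8) :* (p :* x)) := con (ι 8) :* ν :* (p :* (ν :* x))) refl p ν x ⟩
      ι 8 * ν * (p * (ν * x))                 ≡⟨ cong (λ y → ι 8 * ν * (p * y)) νx≡y ⟩
      ι 8 * ν * (p * y)                       ≤⟨ 8npy≤ ⟩
      y * y + ι 16 * (ν * ν)                  ≡⟨ cong (λ y → y * y + ι 16 * (ν * ν)) νx≡y ⟨
      (ν * x) * (ν * x) + ι 16 * (ν * ν)      ≡⟨ solve 2 (λ ν x → (ν :* x) :* (ν :* x) :+ con (ι 16) :* (ν :* ν) := ν :* ν :* (x :* x :+ con (ι 16))) refl ν x ⟩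
      ν * ν * (x * x + ι 16)                  ∎)

    -- With p = 2 m + 1 this is m x ≤ 1 - x / 2 + x² / 16, the expansion of x / (eˣ - 1) with 1 / 16
    -- in place of 1 / 12.
    16μx≤ : ι 16 * (μ * x) ≤ ι 16 - ι 8 * x + x * x
    16μx≤ = begin
      ι 16 * (μ * x)                  ≡⟨ solve 2 (λ μ x → con (ι 16) :* (μ :* x) := con (ι 8) :* ((con (ι 2) :* μ :+ con 1ℚ) :* x) :- con (ι 8) :* x) refl μ x ⟩
      ι 8 * (p * x) - ι 8 * x         ≤⟨ +-monoˡ-≤ (- (ι 8 * x)) 8px≤ ⟩
      x * x + ι 16 - ι 8 * x          ≡⟨ solve 1 (λ x → x :* x :+ con (ι 16) :- con (ι 8) :* x := con (ι 16) :- con (ι 8) :* x :+ x :* x) refl x ⟩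
      ι 16 - ι 8 * x + x * x          ∎

    module _ {k} (4≤k : 4 ℕ.≤ k) where

      e-1 = expSum x k - 1ℚ

      x≤e-1 : x ≤ e-1
      x≤e-1 = begin
        x               ≡⟨ solve 1 (λ x → x := con 1ℚ :+ x :- con 1ℚ) refl x ⟩
        1ℚ + x - 1ℚ     ≤⟨ +-monoˡ-≤ (- 1ℚ) (1+x≤expSum x 0≤x (ℕₚ.≤-trans (ℕ.s≤s (ℕ.s≤s ℕ.z≤n)) 4≤k)) ⟩
        e-1             ∎

      0<e-1 : 0ℚ < e-1
      0<e-1 = <-≤-trans 0<x x≤e-1

      1/n≤∣e-1∣ : + 1 / n ≤ ∣ e-1 ∣
      1/n≤∣e-1∣ = subst (+ 1 / n ≤_) (sym (0≤p⇒∣p∣≡p (<⇒≤ 0<e-1))) (≤-trans 1/n≤x x≤e-1)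

      -- The upper bounds for 16 m x and for 16 (eˣ - 1) / x multiply to 256 up to a cubic deficit
      -- x³ (16 - 3 x), positive because x ≤ 1 / 4; the constant 61 / 4 is 16 - 3 / 4.
      m≤inv[e-1] : μ ≤ inv e-1
      m≤inv[e-1] = ≤-inv {e-1} {μ} 0<e-1 (*-cancelˡ-≤ (ι 256) (0<ι-suc 255) (begin
        ι 256 * (e-1 * μ)                       ≡⟨ solve 2 (λ e μ → con (ι 256) :* (e :* μ) := con (ι 16) :* μ :* (con (ι 16) :* e)) refl e-1 μ ⟩
        ι 16 * μ * (ι 16 * e-1)                 ≤⟨ *-monoˡ {ι 16 * e-1} {x * q} (ι 16 * μ) (*-mono-0≤ {ι 16} {μ} (0≤ι 16) (0≤ι m)) (expSum≤ x 0≤x x≤¼ 4≤k) ⟩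
        ι 16 * μ * (x * q)                      ≡⟨ solve 4 (λ c μ x q → c :* μ :* (x :* q) := c :* (μ :* x) :* q) refl (ι 16) μ x q ⟩
        ι 16 * (μ * x) * q                      ≤⟨ *-monoʳ {ι 16 * (μ * x)} {ι 16 - ι 8 * x + x * x} q 0≤q 16μx≤ ⟩
        (ι 16 - ι 8 * x + x * x) * q            ≤⟨ ≤-from ((ι 16 - ι 8 * x + x * x) * q) (x * x * x * (+ 61 / 4 + ι 3 * (¼ - x)))
                                                     (*-mono-0≤ {x * x * x} {+ 61 / 4 + ι 3 * (¼ - x)} (*-mono-0≤ {x * x} {x} (*-mono-0≤ {x} {x} 0≤x 0≤x) 0≤x)
                                                       (+-mono-0≤ {+ 61 / 4} {ι 3 * (¼ - x)} (<⇒≤ (positive⁻¹ (+ 61 / 4))) (*-mono-0≤ {ι 3} {¼ - x} (0≤ι 3) (0≤q-p x≤¼))))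
                                                     (product x) ⟩
        ι 256 * 1ℚ                              ∎))
        where
        q = ι 16 + ι 8 * x + ι 3 * (x * x)
        0≤q : 0ℚ ≤ q
        0≤q = +-mono-0≤ {ι 16 + ι 8 * x} {ι 3 * (x * x)}
          (+-mono-0≤ {ι 16} {ι 8 * x} (0≤ι 16) (*-mono-0≤ {ι 8} {x} (0≤ι 8) 0≤x))
          (*-mono-0≤ {ι 3} {x * x} (0≤ι 3) (*-mono-0≤ {x} {x} 0≤x 0≤x))
        -- The product is 256 − 16 x³ + 3 x⁴.
        product : ∀ x → ι 256 * 1ℚ ≡ (ι 16 - ι 8 * x + x * x) * (ι 16 + ι 8 * x + ι 3 * (x * x)) + x * x * x * (+ 61 / 4 + ι 3 * (¼ - x))
        product = solve 1 (λ x → con (ι 256) :* con 1ℚ :=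
          (con (ι 16) :- con (ι 8) :* x :+ x :* x) :* (con (ι 16) :+ con (ι 8) :* x :+ con (ι 3) :* (x :* x)) :+ x :* x :* x :* (con (+ 61 / 4) :+ con (ι 3) :* (con ¼ :- x))) refl

      -- Since eˣ - 1 ≥ x, the bound p x ≥ 2 already gives 1 / (eˣ - 1) ≤ m + 1 / 2, and the
      -- remaining 1 / 2 is the separation that strictness asks for.
      inv[e-1]+½≤m+1 : inv e-1 + ½ ≤ μ + 1ℚ
      inv[e-1]+½≤m+1 = begin
        inv e-1 + ½       ≤⟨ +-monoˡ-≤ ½ (inv-antimono {x} {e-1} 0<x x≤e-1) ⟩
        inv x + ½         ≤⟨ +-monoˡ-≤ ½ (inv-≤ {x} {μ + ½} 0<x (begin
                               1ℚ             ≡⟨⟩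
                               ½ * ι 2        ≤⟨ *-monoˡ {ι 2} {p * x} ½ (<⇒≤ (positive⁻¹ ½)) 2≤px ⟩
                               ½ * (p * x)    ≡⟨ solve 2 (λ μ x → con ½ :* ((con (ι 2) :* μ :+ con 1ℚ) :* x) := x :* (μ :+ con ½)) refl μ x ⟩
                               x * (μ + ½)    ∎)) ⟩
        μ + ½ + ½         ≡⟨ +-assoc μ ½ ½ ⟩
        μ + 1ℚ            ∎

    -- This end has ample room: after multiplication by x it only needs x² / 16 ≤ x.
    m-1≤n/y-½ : μ - 1ℚ ≤ ν * inv y - ½
    m-1≤n/y-½ = *-cancelˡ-≤ y 0<y (begin
      y * (μ - 1ℚ)             ≡⟨ cong (_* (μ - 1ℚ)) νx≡y ⟨
      ν * x * (μ - 1ℚ)         ≡⟨ solve 3 (λ ν x μ → ν :* x :* (μ :- con 1ℚ) := ν :* (con (+ 1 / 16)) :* (con (ι 16) :* (μ :* x) :- con (ι 16) :* x)) refl ν x μ ⟩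
      ν * (+ 1 / 16) * (ι 16 * (μ * x) - ι 16 * x)
        ≤⟨ *-monoˡ {ι 16 * (μ * x) - ι 16 * x} {ι 16 - ι 8 * x} (ν * (+ 1 / 16)) (*-mono-0≤ {ν} {+ 1 / 16} (<⇒≤ 0<ν) (<⇒≤ (positive⁻¹ (+ 1 / 16))))
             (begin
               ι 16 * (μ * x) - ι 16 * x           ≤⟨ +-monoˡ-≤ (- (ι 16 * x)) 16μx≤ ⟩
               ι 16 - ι 8 * x + x * x - ι 16 * x   ≤⟨ ≤-from (ι 16 - ι 8 * x + x * x - ι 16 * x) (x * (+ 63 / 4 + (¼ - x)))
                                                        (*-mono-0≤ {x} {+ 63 / 4 + (¼ - x)} 0≤x (+-mono-0≤ {+ 63 / 4} {¼ - x} (<⇒≤ (positive⁻¹ (+ 63 / 4))) (0≤q-p x≤¼)))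
                                                        (solve 1 (λ x → con (ι 16) :- con (ι 8) :* x := con (ι 16) :- con (ι 8) :* x :+ x :* x :- con (ι 16) :* x :+ x :* (con (+ 63 / 4) :+ (con ¼ :- x))) refl x) ⟩
               ι 16 - ι 8 * x                      ∎) ⟩
      ν * (+ 1 / 16) * (ι 16 - ι 8 * x)    ≡⟨ solve 2 (λ ν x → ν :* con (+ 1 / 16) :* (con (ι 16) :- con (ι 8) :* x) := ν :* con 1ℚ :- con ½ :* (ν :* x)) refl ν x ⟩
      ν * 1ℚ - ½ * (ν * x)                 ≡⟨ cong₂ (λ i y → ν * i - ½ * y) (sym (*-inv y (0<⇒≢0 0<y))) νx≡y ⟩
      ν * (y * inv y) - ½ * y              ≡⟨ solve 3 (λ ν y i → ν :* (y :* i) :- con ½ :* y := y :* (ν :* i :- con ½)) refl ν y (inv y) ⟩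
      y * (ν * inv y - ½)                  ∎)

    -- The separation has to serve every `y`: m + 1 / 2 - n / y = (p y - 2 n) / (2 y) ≥ ε / (2 y),
    -- and 4 y ≤ n turns this into 2 ε / n.
    gap : ℚ
    gap = ε * ι 2 * (+ 1 / n)

    0<gap : 0ℚ < gap
    0<gap = *-mono-0< {ε * ι 2} {+ 1 / n} (*-mono-0< {ε} {ι 2} 0<ε (0<ι-suc 1)) 0<1/n

    n/y-½+gap≤m : ν * inv y - ½ + gap ≤ μ
    n/y-½+gap≤m = *-cancelˡ-≤ y 0<y (begin
      y * (ν * inv y - ½ + gap)               ≡⟨ solve 5 (λ ν y i ε r → y :* (ν :* i :- con ½ :+ ε :* con (ι 2) :* r) := ν :* (y :* i) :- con ½ :* y :+ ε :* con (ι 2) :* (r :* y)) refl ν y (inv y) ε (+ 1 / n) ⟩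
      ν * (y * inv y) - ½ * y + ε * ι 2 * x   ≡⟨ cong (λ i → ν * i - ½ * y + ε * ι 2 * x) (*-inv y (0<⇒≢0 0<y)) ⟩
      ν * 1ℚ - ½ * y + ε * ι 2 * x            ≤⟨ +-monoʳ-≤ (ν * 1ℚ - ½ * y) (*-monoˡ {x} {¼} (ε * ι 2) (*-mono-0≤ {ε} {ι 2} (<⇒≤ 0<ε) (0≤ι 2)) x≤¼) ⟩
      ν * 1ℚ - ½ * y + ε * ι 2 * ¼            ≡⟨ solve 3 (λ ν y ε → ν :* con 1ℚ :- con ½ :* y :+ ε :* con (ι 2) :* con ¼ := con ½ :* (con (ι 2) :* ν :+ ε) :- con ½ :* y) refl ν y ε ⟩
      ½ * (ι 2 * ν + ε) - ½ * y               ≤⟨ +-monoˡ-≤ (- (½ * y)) (*-monoˡ {ι 2 * ν + ε} {p * y} ½ (<⇒≤ (positive⁻¹ ½)) 2n+ε≤py) ⟩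
      ½ * (p * y) - ½ * y                     ≡⟨ solve 2 (λ μ y → con ½ :* ((con (ι 2) :* μ :+ con 1ℚ) :* y) :- con ½ :* y := y :* μ) refl μ y ⟩
      y * μ                                   ∎)

  -- Casts of natural numbers, the excess p y - 2 n, absolute values

  ι-+ : ∀ m n → ι (m ℕ.+ n) ≡ ι m + ι n
  ι-+ m n = /1-+ (+ m) (+ n)

  ι-* : ∀ m n → ι (m ℕ.* n) ≡ ι m * ι n
  ι-* zero    n = sym (*-zeroˡ (ι n))
  ι-* (suc m) n = begin-equality
    ι (n ℕ.+ m ℕ.* n)     ≡⟨ ι-+ n (m ℕ.* n) ⟩
    ι n + ι (m ℕ.* n)     ≡⟨ cong (_+_ (ι n)) (ι-* m n) ⟩
    ι n + ι m * ι n       ≡⟨ solve 2 (λ m n → n :+ m :* n := (con 1ℚ :+ m) :* n) refl (ι m) (ι n) ⟩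
    (1ℚ + ι m) * ι n      ≡⟨ cong (_* ι n) (ι-suc m) ⟨
    ι (suc m) * ι n       ∎

  ι-*+ : ∀ m n o → ι (m ℕ.* n ℕ.+ o) ≡ ι m * ι n + ι o
  ι-*+ m n o = trans (ι-+ (m ℕ.* n) o) (cong (_+ ι o) (ι-* m n))

  -- Both families control the excess `d` directly. The condition 8 n d ≤ y² is p x - 2 ≤ x² / 8
  -- multiplied by 8 n².
  excess⇒approximates : ∀ {n m ε y} d → (ι 2 * ι m + 1ℚ) * y ≡ ι 2 * ι n + d →
                        ε ≤ d → ι 8 * ι n * d ≤ y * y → 1ℚ ≤ y → ι 4 * y ≤ ι n → Approximates n m ε y
  excess⇒approximates {n} {m} {ε} {y} d py≡ ε≤d 8nd≤y² 1≤y 4y≤n = record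
    { 1≤y = 1≤y
    ; 4y≤n = 4y≤n
    ; 2n+ε≤py = subst (ι 2 * ι n + ε ≤_) (sym py≡) (+-monoʳ-≤ (ι 2 * ι n) ε≤d)
    ; 8npy≤ = begin
        ι 8 * ι n * ((ι 2 * ι m + 1ℚ) * y)        ≡⟨ cong (ι 8 * ι n *_) py≡ ⟩
        ι 8 * ι n * (ι 2 * ι n + d)               ≡⟨ solve 2 (λ n d → con (ι 8) :* n :* (con (ι 2) :* n :+ d) := con (ι 8) :* n :* d :+ con (ι 16) :* (n :* n)) refl (ι n) d ⟩
        ι 8 * ι n * d + ι 16 * (ι n * ι n)        ≤⟨ +-monoˡ-≤ (ι 16 * (ι n * ι n)) 8nd≤y² ⟩
        y * y + ι 16 * (ι n * ι n)                ∎
    }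

  p≤∣p∣ : ∀ p → p ≤ ∣ p ∣
  p≤∣p∣ p with ∣p∣≡p∨∣p∣≡-p p
  ... | inj₁ eq = ≤-reflexive (sym eq)
  ... | inj₂ eq = ≤-from p (∣ p ∣ + ∣ p ∣) (+-mono-0≤ {∣ p ∣} {∣ p ∣} (0≤∣p∣ p) (0≤∣p∣ p))
    (subst (λ a → a ≡ p + (a + a)) (sym eq) (solve 1 (λ p → :- p := p :+ (:- p :+ :- p)) refl p))

  -∣p∣≤p : ∀ p → - ∣ p ∣ ≤ p
  -∣p∣≤p p = subst₂ _≤_ (cong -_ (∣-p∣≡∣p∣ p)) (solve 1 (λ p → :- (:- p) := p) refl p) (neg-antimono-≤ (p≤∣p∣ (- p)))

  -- Asking only for a positive sum makes this applicable to an approximation of a square root whose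
  -- own sign is not yet known.
  square-cancel-≤ : ∀ {p q} → 0ℚ < q + p → p * p ≤ q * q → p ≤ q
  square-cancel-≤ {p} {q} 0<q+p p²≤q² = ≤-from p (q - p)
    (*-cancelˡ-≤ (q + p) {0ℚ} {q - p} 0<q+p (subst₂ _≤_ (sym (*-zeroʳ (q + p)))
      (solve 2 (λ p q → q :* q :- p :* p := (q :+ p) :* (q :- p)) refl p q) (0≤q-p p²≤q²)))
    (solve 2 (λ p q → q := p :+ (q :- p)) refl p q)

  -- Continued fractions with quotient 4 at even indices

  module QuotientsFour where

    -- The shape of the quotients from an even index ≥ 2 onwards; it starts with a 4 and survives a
    -- shift by two.
    record Fours (b : ℕ → ℤ) : Set where
      field
        positive : Positive-all b
        four     : ∀ k → b (2 ℕ.* k) ≡ + 4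

    open Fours

    fours-shift : ∀ {b} → Fours b → Fours (b ∘ suc ∘ suc)
    fours-shift {b} f = record
      { positive = positive f ∘ suc ∘ suc
      ; four     = λ k → subst (λ i → b i ≡ + 4) (ℕₚ.*-suc 2 k) (four f (suc k)) }

    twoSteps : ∀ b t → 0ℚ ≤ b → 0ℚ < t → inv (b + inv t) * (b * t + 1ℚ) ≡ t
    twoSteps b t 0≤b 0<t = begin-equality
      inv w * (b * t + 1ℚ)            ≡⟨ cong (λ i → inv w * (b * t + i)) (*-inv t (0<⇒≢0 0<t)) ⟨
      inv w * (b * t + t * inv t)     ≡⟨ solve 4 (λ i b t j → i :* (b :* t :+ t :* j) := (b :+ j) :* i :* t) refl (inv w) b t (inv t) ⟩
      w * inv w * t                   ≡⟨ cong (_* t) (*-inv w (0<⇒≢0 (<-≤-trans (inv-0< 0<t) (≤-from (inv t) b 0≤b (+-comm b (inv t)))))) ⟩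
      1ℚ * t                          ≡⟨ *-identityˡ t ⟩
      t                               ∎
      where w = b + inv t

    -- (2 m + 1) / q and 2 m′ / q′ are the last two convergents before the tail b; the
    -- determinant is +1 because the last one has odd index.
    record Convergents (c : ℕ → ℚ) (b : ℕ → ℤ) : Set where
      field
        m m′ q q′ : ℕ
        0<q       : 0 ℕ.< q
      p  = ι 2 * ι m + 1ℚ
      p′ = ι 2 * ι m′
      field
        determinant : p * ι q′ ≡ p′ * ι q + 1ℚ
        möbius      : ∀ j → c j * (ι q * convergent b j + ι q′) ≡ p * convergent b j + p′

    open Convergents

    ∣_∣-cast : ∀ {i} → 0ℤ ℤ.< i → ι ℤ.∣ i ∣ ≡ i / 1
    ∣ 0<i ∣-cast = cong (_/ 1) (ℤₚ.0≤i⇒+∣i∣≡i (ℤₚ.<⇒≤ 0<i))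

    convergents-start : ∀ {a} → a 0 ≡ 0ℤ → a 1 ≡ + 2 → Positive-all (a ∘ suc ∘ suc) →
                        Convergents (λ j → convergent a (2 ℕ.+ j)) (a ∘ suc ∘ suc)
    convergents-start {a} a₀≡0 a₁≡2 a>0 = record
      -- The convergents 0 / 1 and 1 / 2 given by the quotients 0, 2.
      { m = 0 ; m′ = 0 ; q = 2 ; q′ = 1 ; 0<q = ℕ.s≤s ℕ.z≤n
      ; determinant = refl
      ; möbius = λ j → let t = convergent (a ∘ suc ∘ suc) j in begin-equality
          (a 0 / 1 + inv (a 1 / 1 + inv t)) * (ι 2 * t + 1ℚ)    ≡⟨ cong₂ (λ i k → (i / 1 + inv (k / 1 + inv t)) * (ι 2 * t + 1ℚ)) a₀≡0 a₁≡2 ⟩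
          (0ℚ + inv (ι 2 + inv t)) * (ι 2 * t + 1ℚ)             ≡⟨ cong (_* (ι 2 * t + 1ℚ)) (+-identityˡ (inv (ι 2 + inv t))) ⟩
          inv (ι 2 + inv t) * (ι 2 * t + 1ℚ)                    ≡⟨ twoSteps (ι 2) t (0≤ι 2) (<-≤-trans 0<1 (1≤convergent a>0 j)) ⟩
          t                                                     ≡⟨ solve 1 (λ t → t := con 1ℚ :* t :+ con 0ℚ) refl t ⟩
          1ℚ * t + 0ℚ                                           ∎
      }

    -- Passing the quotients 4 and `β` flips the determinant twice. The intermediate numerator 4 p +
    -- p′ is even because 4 and p′ are, so β (4 p + p′) + p is odd whatever `β` is.
    convergents-next : ∀ {c b} → Fours b → Convergents c b → Convergents (λ j → c (2 ℕ.+ j)) (b ∘ suc ∘ suc)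
    convergents-next {c} {b} f s = record
      { m = m⁺ ; m′ = m″ ; q = q⁺ ; q′ = q″
      ; 0<q = ℕₚ.≤-trans (0<q s) (ℕₚ.m≤n+m (q s) (β ℕ.* q″))
      ; determinant = begin-equality
          (ι 2 * ι m⁺ + 1ℚ) * ι q″                                ≡⟨ cong₂ _*_ p⁺≡ ιq″≡ ⟩
          (ι β * P″ + P) * (ι 4 * Q + Q′)                         ≡⟨ solve 5 (λ β P P′ Q Q′ → (β :* (con (ι 4) :* P :+ P′) :+ P) :* (con (ι 4) :* Q :+ Q′) := β :* (con (ι 4) :* P :+ P′) :* (con (ι 4) :* Q :+ Q′) :+ con (ι 4) :* P :* Q :+ P :* Q′) refl (ι β) P P′ Q Q′ ⟩
          ι β * P″ * Q″ + ι 4 * P * Q + P * Q′                    ≡⟨ cong (_+_ (ι β * P″ * Q″ + ι 4 * P * Q)) (determinant s) ⟩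
          ι β * P″ * Q″ + ι 4 * P * Q + (P′ * Q + 1ℚ)             ≡⟨ solve 5 (λ β P P′ Q Q′ → β :* (con (ι 4) :* P :+ P′) :* (con (ι 4) :* Q :+ Q′) :+ con (ι 4) :* P :* Q :+ (P′ :* Q :+ con 1ℚ) := (con (ι 4) :* P :+ P′) :* (β :* (con (ι 4) :* Q :+ Q′) :+ Q) :+ con 1ℚ) refl (ι β) P P′ Q Q′ ⟩
          P″ * (ι β * Q″ + Q) + 1ℚ                                ≡⟨ cong₂ (λ i j → i * j + 1ℚ) p″≡ ιq⁺≡ ⟨
          ι 2 * ι m″ * ι q⁺ + 1ℚ                                  ∎
      ; möbius = λ j →
          let t  = convergent (b ∘ suc ∘ suc) j
              i  = inv (ι β + inv t)
              -- Multiplying the old Möbius relation by `w` removes the reciprocal `i`, since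
              -- `i * w` is `t`.
              w  = ι β * t + 1ℚ
              cⱼ = c (2 ℕ.+ j)
              iw≡t : i * w ≡ t
              iw≡t = twoSteps (ι β) t (0≤ι β) (<-≤-trans 0<1 (1≤convergent (positive f ∘ suc ∘ suc) j))
              t₂≡ : convergent b (2 ℕ.+ j) ≡ ι 4 + i
              t₂≡ = cong₂ (λ k l → k / 1 + inv (l + inv t)) (four f 0) (sym (∣ positive f 1 ∣-cast))
          in begin-equality
          cⱼ * (ι q⁺ * t + ι q″)                    ≡⟨ cong₂ (λ k l → cⱼ * (k * t + l)) ιq⁺≡ ιq″≡ ⟩
          cⱼ * ((ι β * Q″ + Q) * t + Q″)            ≡⟨ solve 5 (λ c β Q Q″ t → c :* ((β :* Q″ :+ Q) :* t :+ Q″) := c :* (Q″ :* (β :* t :+ con 1ℚ) :+ Q :* t)) refl cⱼ (ι β) Q Q″ t ⟩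
          cⱼ * (Q″ * w + Q * t)                     ≡⟨ cong (λ t → cⱼ * (Q″ * w + Q * t)) iw≡t ⟨
          cⱼ * (Q″ * w + Q * (i * w))               ≡⟨ solve 5 (λ c Q Q′ w i → c :* ((con (ι 4) :* Q :+ Q′) :* w :+ Q :* (i :* w)) := c :* (Q :* (con (ι 4) :+ i) :+ Q′) :* w) refl cⱼ Q Q′ w i ⟩
          cⱼ * (Q * (ι 4 + i) + Q′) * w             ≡⟨ cong (λ u → cⱼ * (Q * u + Q′) * w) t₂≡ ⟨
          cⱼ * (Q * convergent b (2 ℕ.+ j) + Q′) * w ≡⟨ cong (_* w) (möbius s (2 ℕ.+ j)) ⟩
          (P * convergent b (2 ℕ.+ j) + P′) * w     ≡⟨ cong (λ u → (P * u + P′) * w) t₂≡ ⟩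
          (P * (ι 4 + i) + P′) * w                  ≡⟨ solve 4 (λ P P′ w i → (P :* (con (ι 4) :+ i) :+ P′) :* w := (con (ι 4) :* P :+ P′) :* w :+ P :* (i :* w)) refl P P′ w i ⟩
          P″ * w + P * (i * w)                      ≡⟨ cong (λ t → P″ * w + P * t) iw≡t ⟩
          P″ * w + P * t                            ≡⟨ solve 4 (λ β P P″ t → P″ :* (β :* t :+ con 1ℚ) :+ P :* t := (β :* P″ :+ P) :* t :+ P″) refl (ι β) P P″ t ⟩
          (ι β * P″ + P) * t + P″                   ≡⟨ cong₂ (λ k l → k * t + l) p⁺≡ p″≡ ⟨
          (ι 2 * ι m⁺ + 1ℚ) * t + ι 2 * ι m″        ∎
      }
      where
      β = ℤ.∣ b 1 ∣
      -- Half of 4 (2 m + 1) + 2 m′.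
      m″ = 4 ℕ.* m s ℕ.+ (2 ℕ.+ m′ s)
      m⁺ = β ℕ.* m″ ℕ.+ m s
      q″ = 4 ℕ.* q s ℕ.+ q′ s
      q⁺ = β ℕ.* q″ ℕ.+ q s
      P = p s
      P′ = p′ s
      Q = ι (q s)
      Q′ = ι (q′ s)
      P″ = ι 4 * P + P′
      Q″ = ι 4 * Q + Q′
      ιq″≡ : ι q″ ≡ Q″
      ιq″≡ = ι-*+ 4 (q s) (q′ s)
      ιq⁺≡ : ι q⁺ ≡ ι β * Q″ + Q
      ιq⁺≡ = trans (ι-*+ β q″ (q s)) (cong (λ x → ι β * x + Q) ιq″≡)
      ιm″≡ : ι m″ ≡ ι 4 * ι (m s) + (ι 2 + ι (m′ s))
      ιm″≡ = trans (ι-*+ 4 (m s) (2 ℕ.+ m′ s)) (cong (_+_ (ι 4 * ι (m s))) (ι-+ 2 (m′ s)))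
      p″≡ : ι 2 * ι m″ ≡ P″
      p″≡ = trans (cong (ι 2 *_) ιm″≡) (solve 2 (λ m m′ → con (ι 2) :* (con (ι 4) :* m :+ (con (ι 2) :+ m′)) := con (ι 4) :* (con (ι 2) :* m :+ con 1ℚ) :+ con (ι 2) :* m′) refl (ι (m s)) (ι (m′ s)))
      p⁺≡ : ι 2 * ι m⁺ + 1ℚ ≡ ι β * P″ + P
      p⁺≡ = begin-equality
        ι 2 * ι m⁺ + 1ℚ                         ≡⟨ cong (λ x → ι 2 * x + 1ℚ) (ι-*+ β m″ (m s)) ⟩
        ι 2 * (ι β * ι m″ + ι (m s)) + 1ℚ       ≡⟨ solve 3 (λ β m″ m → con (ι 2) :* (β :* m″ :+ m) :+ con 1ℚ := β :* (con (ι 2) :* m″) :+ (con (ι 2) :* m :+ con 1ℚ)) refl (ι β) (ι m″) (ι (m s)) ⟩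
        ι β * (ι 2 * ι m″) + P                  ≡⟨ cong (λ x → ι β * x + P) p″≡ ⟩
        ι β * P″ + P                            ∎

    q-increases : ∀ {c b} (f : Fours b) (s : Convergents c b) → q s ℕ.< q (convergents-next f s)
    q-increases {b = b} f s = ℕₚ.+-monoˡ-≤ (q s) (ℕₚ.*-mono-≤ {1} {ℤ.∣ b 1 ∣} {1} {4 ℕ.* q s ℕ.+ q′ s} 1≤β
      (ℕₚ.≤-trans (0<q s) (ℕₚ.≤-trans (ℕₚ.m≤n*m (q s) 4) (ℕₚ.m≤m+n (4 ℕ.* q s) (q′ s)))))
      where
      1≤β : 1 ℕ.≤ ℤ.∣ b 1 ∣
      1≤β = ℤₚ.drop‿+≤+ (subst (ℤ.1ℤ ℤ.≤_) (sym (ℤₚ.0≤i⇒+∣i∣≡i (ℤₚ.<⇒≤ (positive f 1)))) (ℤₚ.i<j⇒suc[i]≤j (positive f 1)))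

    convergents-far : ∀ k {c b} → Fours b → (s : Convergents c b) →
                      ∃[ i ] ∃[ b⁺ ] Fours b⁺ × Σ[ s⁺ ∈ Convergents (λ j → c (i ℕ.+ j)) b⁺ ] k ℕ.+ q s ℕ.≤ q s⁺
    convergents-far zero    {b = b} f s = 0 , b , f , s , ℕₚ.≤-refl
    convergents-far (suc k) f s =
      let i , b⁺ , f⁺ , s⁺ , k+q≤ = convergents-far k (fours-shift f) (convergents-next f s)
      in 2 ℕ.+ i , b⁺ , f⁺ , s⁺ , ℕₚ.≤-trans (ℕₚ.≤-reflexive (sym (ℕₚ.+-suc k (q s)))) (ℕₚ.≤-trans (ℕₚ.+-monoʳ-≤ k (q-increases f s)) k+q≤)

    module FirstQuotients {a : ℕ → ℤ} (a₀≡0 : a 0 ≡ 0ℤ) (a₁≡2 : a 1 ≡ + 2) (a>0 : Positive-all (a ∘ suc ∘ suc)) (j : ℕ) where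
      t = convergent (a ∘ suc ∘ suc) j
      c = convergent a (2 ℕ.+ j)
      y = ι 2 * inv c
      w = ι 2 + inv t

      0<w : 0ℚ < w
      0<w = +-mono-< {0ℚ} {ι 2} {0ℚ} {inv t} (0<ι-suc 1) (inv-0< (<-≤-trans 0<1 (1≤convergent a>0 j)))

      c≡ : c ≡ inv w
      c≡ = trans (cong₂ (λ i k → i / 1 + inv (k / 1 + inv t)) a₀≡0 a₁≡2) (+-identityˡ (inv w))

      cw≡1 : c * w ≡ 1ℚ
      cw≡1 = trans (cong (_* w) c≡) (trans (*-comm (inv w) w) (*-inv w (0<⇒≢0 0<w)))

      0<c : 0ℚ < c
      0<c = subst (0ℚ <_) (sym c≡) (inv-0< 0<w)

      cy≡2 : c * y ≡ ι 2
      cy≡2 = trans (solve 2 (λ c i → c :* (con (ι 2) :* i) := con (ι 2) :* (c :* i)) refl c (inv c)) (cong (ι 2 *_) (*-inv c (0<⇒≢0 0<c)))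

      -- Writes y = 2 / c as 4 + 2 / t with t ≥ 1, which confines it to [4, 6] for every truncation.
      y≡2w : y ≡ ι 2 * w
      y≡2w = cong (ι 2 *_) (begin-equality
        inv c             ≡⟨ *-identityʳ (inv c) ⟨
        inv c * 1ℚ        ≡⟨ cong (inv c *_) cw≡1 ⟨
        inv c * (c * w)   ≡⟨ solve 3 (λ i c w → i :* (c :* w) := c :* i :* w) refl (inv c) c w ⟩
        c * inv c * w     ≡⟨ cong (_* w) (*-inv c (0<⇒≢0 0<c)) ⟩
        1ℚ * w            ≡⟨ *-identityˡ w ⟩
        w                 ∎)

      4≤y : ι 4 ≤ y
      4≤y = subst (ι 4 ≤_) (sym y≡2w) (*-monoˡ {ι 2} {w} (ι 2) (0≤ι 2) (p≤p+q {ι 2} {inv t} (<⇒≤ (inv-0< (<-≤-trans 0<1 (1≤convergent a>0 j))))))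

      y≤6 : y ≤ ι 6
      y≤6 = subst (_≤ ι 6) (sym y≡2w) (*-monoˡ {w} {ι 3} (ι 2) (0≤ι 2) (+-monoʳ-≤ (ι 2) (inv-antimono {1ℚ} {t} 0<1 (1≤convergent a>0 j))))

    -- The bound 24 = 4 · 6 secures 4 y ≤ n for y ≤ 6.
    module MöbiusExcess {c : ℕ → ℚ} {b : ℕ → ℤ} (f : Fours b) (s : Convergents c b) (24≤q : 24 ℕ.≤ q s) where

      Q = ι (q s)
      Q′ = ι (q′ s)
      P = p s
      P′ = p′ s

      0<Q : 0ℚ < Q
      0<Q = <-≤-trans 0<1 (ι-mono {1} {q s} (0<q s))

      -- The least value that 1 / (q t + q′) can take for a tail t ≤ 5.
      ε : ℚ
      ε = inv (Q * ι 5 + Q′)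

      0<ε : 0ℚ < ε
      0<ε = inv-0< (<-≤-trans (*-mono-0< {Q} {ι 5} 0<Q (0<ι-suc 4)) (p≤p+q {Q * ι 5} {Q′} (0≤ι (q′ s))))

      module _ (j : ℕ) where
        t = convergent b j
        w = Q * t + Q′
        d = P - Q * c j

        4≤t : ι 4 ≤ t
        4≤t = subst (λ i → i / 1 ≤ t) (four f 0) (a₀≤convergent (positive f ∘ suc) j)

        t≤5 : t ≤ ι 5
        t≤5 = subst (λ i → t ≤ i / 1 + 1ℚ) (four f 0) (convergent≤a₀+1 (positive f ∘ suc) j)

        4Q≤w : Q * ι 4 ≤ w
        4Q≤w = ≤-trans (*-monoˡ {ι 4} {t} Q (<⇒≤ 0<Q) 4≤t) (p≤p+q {Q * t} {Q′} (0≤ι (q′ s)))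

        0<w : 0ℚ < w
        0<w = <-≤-trans (*-mono-0< {Q} {ι 4} 0<Q (0<ι-suc 3)) 4Q≤w

        -- The classical error formula for convergents: after the Möbius relation is substituted,
        -- only the determinant survives.
        dw≡1 : d * w ≡ 1ℚ
        dw≡1 = begin-equality
          (P - Q * c j) * w                     ≡⟨ solve 4 (λ P Q c w → (P :- Q :* c) :* w := P :* w :- Q :* (c :* w)) refl P Q (c j) w ⟩
          P * w - Q * (c j * w)                 ≡⟨ cong (λ u → P * w - Q * u) (möbius s j) ⟩
          P * w - Q * (P * t + P′)              ≡⟨ solve 5 (λ P Q P′ Q′ t → P :* (Q :* t :+ Q′) :- Q :* (P :* t :+ P′) := P :* Q′ :- P′ :* Q) refl P Q P′ Q′ t ⟩
          P * Q′ - P′ * Q                       ≡⟨ cong (_- P′ * Q) (determinant s) ⟩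
          P′ * Q + 1ℚ - P′ * Q                  ≡⟨ solve 1 (λ u → u :+ con 1ℚ :- u := con 1ℚ) refl (P′ * Q) ⟩
          1ℚ                                    ∎

        d≡inv : inv w ≡ d
        d≡inv = begin-equality
          inv w               ≡⟨ *-identityˡ (inv w) ⟨
          1ℚ * inv w          ≡⟨ cong (_* inv w) dw≡1 ⟨
          d * w * inv w       ≡⟨ *-assoc d w (inv w) ⟩
          d * (w * inv w)     ≡⟨ cong (d *_) (*-inv w (0<⇒≢0 0<w)) ⟩
          d * 1ℚ              ≡⟨ *-identityʳ d ⟩
          d                   ∎

        0≤d : 0ℚ ≤ d
        0≤d = subst (0ℚ ≤_) d≡inv (<⇒≤ (inv-0< 0<w))

        ε≤d : ε ≤ d
        ε≤d = subst (ε ≤_) d≡inv (inv-antimono {w} {Q * ι 5 + Q′} 0<w (+-monoˡ-≤ Q′ (*-monoˡ {t} {ι 5} Q (<⇒≤ 0<Q) t≤5)))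

        -- The excess is `d * y`. The quotient 4 enters through 4 q d ≤ d w = 1, whence 8 q d y ≤ 2
        -- y ≤ y².
        convergents⇒approximates : ∀ y → c j * y ≡ ι 2 → ι 4 ≤ y → y ≤ ι 6 → Approximates (q s) (m s) ε y
        convergents⇒approximates y cy≡2 4≤y y≤6 = excess⇒approximates (d * y)
          (begin-equality
            P * y                         ≡⟨ solve 4 (λ P Q c y → P :* y := (c :* y) :* Q :+ (P :- Q :* c) :* y) refl P Q (c j) y ⟩
            c j * y * Q + d * y           ≡⟨ cong (λ u → u * Q + d * y) cy≡2 ⟩
            ι 2 * Q + d * y               ∎)
          (begin
            ε             ≤⟨ ε≤d ⟩
            d             ≡⟨ *-identityʳ d ⟨
            d * 1ℚ        ≤⟨ *-monoˡ {1ℚ} {y} d 0≤d 1≤y ⟩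
            d * y         ∎)
          (begin
            ι 8 * Q * (d * y)             ≡⟨ solve 3 (λ Q d y → con (ι 8) :* Q :* (d :* y) := (con (ι 2) :* y) :* (d :* (Q :* con (ι 4)))) refl Q d y ⟩
            ι 2 * y * (d * (Q * ι 4))     ≤⟨ *-monoˡ {d * (Q * ι 4)} {d * w} (ι 2 * y) (*-mono-0≤ {ι 2} {y} (0≤ι 2) 0≤y) (*-monoˡ {Q * ι 4} {w} d 0≤d 4Q≤w) ⟩
            ι 2 * y * (d * w)             ≡⟨ cong (ι 2 * y *_) dw≡1 ⟩
            ι 2 * y * 1ℚ                  ≡⟨ *-identityʳ (ι 2 * y) ⟩
            ι 2 * y                       ≤⟨ *-monoʳ {ι 2} {y} y 0≤y (≤-trans (ι-mono {2} {4} (ℕ.s≤s (ℕ.s≤s ℕ.z≤n))) 4≤y) ⟩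
            y * y                         ∎)
          1≤y
          (≤-trans (*-monoˡ {y} {ι 6} (ι 4) (0≤ι 4) y≤6) (ι-mono {24} {q s} 24≤q))
          where
          1≤y : 1ℚ ≤ y
          1≤y = ≤-trans (ι-mono {1} {4} (ℕ.s≤s ℕ.z≤n)) 4≤y
          0≤y : 0ℚ ≤ y
          0≤y = ≤-trans (0≤ι 4) 4≤y

  -- A Pell recurrence for √(c (c + 1))

  module Pell where

    -- With w = √(c (c + 1)) − c, the equation says that p w − 2 v has
    -- norm − c; then p y − 2 n = p w − 2 v for y = 4 + w and n = 2 p + v.
    record Solution (c : ℕ) : Set where
      field
        m v : ℕ
      C = ι c
      P = ι 2 * ι m + 1ℚ
      V = ι v
      field
        pell : C * (P * P) ≡ ι 4 * (C * (P * V)) + ι 4 * (V * V) + C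

    open Solution using (m; v; pell)

    trivialSolution : ∀ c → Solution c
    trivialSolution c = record { m = 0 ; v = 0 ; pell = solve 1 (λ C → C :* con 1ℚ := con (ι 4) :* (C :* con 0ℚ) :+ con 0ℚ :+ C) refl (ι c) }

    -- Multiplication of p w − 2 v by the unit 2 c + 1 − 2 √(c (c + 1)).
    nextSolution : ∀ {c} → Solution c → Solution c
    nextSolution {c} s = record { m = m⁺ ; v = v⁺ ; pell = begin-equality
        C * (P⁺ * P⁺)                                                 ≡⟨ cong (λ P → C * (P * P)) P⁺≡ ⟩
        C * ((ι 4 * W + P) * (ι 4 * W + P))                           ≡⟨ solve 3 (λ C P V → let W = C :* P :+ V in C :* ((con (ι 4) :* W :+ P) :* (con (ι 4) :* W :+ P))
                                                                           := con (ι 16) :* C :* W :* W :+ con (ι 8) :* C :* P :* W :+ C :* (P :* P)) refl C P V ⟩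
        ι 16 * C * W * W + ι 8 * C * P * W + C * (P * P)              ≡⟨ cong (_+_ (ι 16 * C * W * W + ι 8 * C * P * W)) (pell s) ⟩
        ι 16 * C * W * W + ι 8 * C * P * W + (ι 4 * (C * (P * V)) + ι 4 * (V * V) + C)
                                                                      ≡⟨ solve 3 (λ C P V → let W = C :* P :+ V in
                                                                             con (ι 16) :* C :* W :* W :+ con (ι 8) :* C :* P :* W :+ (con (ι 4) :* (C :* (P :* V)) :+ con (ι 4) :* (V :* V) :+ C)
                                                                           := con (ι 4) :* (C :* ((con (ι 4) :* W :+ P) :* W)) :+ con (ι 4) :* (W :* W) :+ C) refl C P V ⟩
        ι 4 * (C * ((ι 4 * W + P) * W)) + ι 4 * (W * W) + C           ≡⟨ cong₂ (λ P V → ι 4 * (C * (P * V)) + ι 4 * (V * V) + C) P⁺≡ W≡ ⟨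
        ι 4 * (C * (P⁺ * ι v⁺)) + ι 4 * (ι v⁺ * ι v⁺) + C             ∎ }
      where
      open Solution s using (C; P; V)
      p = 2 ℕ.* m s ℕ.+ 1
      -- The unit is 1 - 2 w and w² = c - 2 c w, so the product is (p + 4 (c p + v)) w - 2 (c p +
      -- v). The coefficient p changes by a multiple of 4 and stays odd.
      v⁺ = c ℕ.* p ℕ.+ v s
      m⁺ = 2 ℕ.* v⁺ ℕ.+ m s
      W = C * P + V
      P⁺ = ι 2 * ι m⁺ + 1ℚ
      W≡ : ι v⁺ ≡ W
      W≡ = trans (ι-*+ c p (v s)) (cong (λ P → C * P + V) (ι-*+ 2 (m s) 1))
      P⁺≡ : P⁺ ≡ ι 4 * W + P
      P⁺≡ = trans (cong (λ i → ι 2 * i + 1ℚ) (trans (ι-*+ 2 v⁺ (m s)) (cong (λ w → ι 2 * w + ι (m s)) W≡)))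
        (solve 2 (λ W m → con (ι 2) :* (con (ι 2) :* W :+ m) :+ con 1ℚ := con (ι 4) :* W :+ (con (ι 2) :* m :+ con 1ℚ)) refl W (ι (m s)))

    v-increases : ∀ {c} .{{_ : NonZero c}} (s : Solution c) → v s ℕ.< v (nextSolution s)
    v-increases {c} s = ℕₚ.+-monoˡ-≤ (v s) (ℕₚ.*-mono-≤ {1} {c} {1} {2 ℕ.* m s ℕ.+ 1} (ℕ.>-nonZero⁻¹ c) (ℕₚ.m≤n+m 1 (2 ℕ.* m s)))

    largeSolution : ∀ c .{{_ : NonZero c}} k → Σ[ s ∈ Solution c ] k ℕ.≤ v s
    largeSolution c zero    = trivialSolution c , ℕ.z≤n
    largeSolution c (suc k) = let s , k≤v = largeSolution c k in nextSolution s , ℕₚ.≤-<-trans k≤v (v-increases s)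

    -- The bound 20 = 4 · 5 secures 4 y ≤ n for y ≤ 5.
    module PellExcess (c : ℕ) .{{_ : NonZero c}} (sol : Solution c) (20≤v : 20 ℕ.≤ v sol) where
      open Solution sol using (C; P; V)

      n : ℕ
      n = 4 ℕ.* m sol ℕ.+ (2 ℕ.+ v sol)

      v≤n : v sol ℕ.≤ n
      v≤n = ℕₚ.≤-trans (ℕₚ.m≤n+m (v sol) 2) (ℕₚ.m≤n+m (2 ℕ.+ v sol) (4 ℕ.* m sol))

      n≡ : ι n ≡ ι 2 * P + V
      n≡ = trans (ι-*+ 4 (m sol) (2 ℕ.+ v sol)) (trans (cong (_+_ (ι 4 * ι (m sol))) (ι-+ 2 (v sol)))
        (solve 2 (λ m V → con (ι 4) :* m :+ (con (ι 2) :+ V) := con (ι 2) :* (con (ι 2) :* m :+ con 1ℚ) :+ V) refl (ι (m sol)) V))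

      1≤C : 1ℚ ≤ C
      1≤C = ι-mono {1} {c} (ℕ.>-nonZero⁻¹ c)

      0≤C : 0ℚ ≤ C
      0≤C = 0≤ι c

      0≤V : 0ℚ ≤ V
      0≤V = 0≤ι (v sol)

      1≤P : 1ℚ ≤ P
      1≤P = ≤-from 1ℚ (ι 2 * ι (m sol)) (*-mono-0≤ {ι 2} {ι (m sol)} (0≤ι 2) (0≤ι (m sol))) (+-comm (ι 2 * ι (m sol)) 1ℚ)

      0<P : 0ℚ < P
      0<P = <-≤-trans 0<1 1≤P

      0≤P : 0ℚ ≤ P
      0≤P = <⇒≤ 0<P

      0<CP : 0ℚ < C * P
      0<CP = *-mono-0< {C} {P} (<-≤-trans 0<1 1≤C) 0<P

      V≤P : V ≤ P
      V≤P = begin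
        V           ≤⟨ ≤-from V (ι 3 * V) (*-mono-0≤ {ι 3} {V} (0≤ι 3) 0≤V) (solve 1 (λ V → con (ι 4) :* V := V :+ con (ι 3) :* V) refl V) ⟩
        ι 4 * V     ≤⟨ *-cancelˡ-≤ (C * P) {ι 4 * V} {P} 0<CP (≤-from (C * P * (ι 4 * V)) (ι 4 * (V * V) + C)
                         (+-mono-0≤ {ι 4 * (V * V)} {C} (*-mono-0≤ {ι 4} {V * V} (0≤ι 4) (*-mono-0≤ {V} {V} 0≤V 0≤V)) 0≤C)
                         (trans (trans (*-assoc C P P) (pell sol)) (solve 3 (λ C P V → con (ι 4) :* (C :* (P :* V)) :+ con (ι 4) :* (V :* V) :+ C := C :* P :* (con (ι 4) :* V) :+ (con (ι 4) :* (V :* V) :+ C)) refl C P V))) ⟩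
        P           ∎

      -- `η` is the tolerance on s² that perturbs the norm by at most P² η = 1 / 4. `largestFactor`
      -- bounds the conjugate factor through s ≤ c + 1, so `ε` bounds the excess below as soon as
      -- the perturbed norm is at least 1 / 2.
      η ε largestFactor : ℚ
      η = inv (ι 4 * (P * P))
      largestFactor = P * (C + 1ℚ) + P * C + ι 2 * V
      ε = ½ * inv largestFactor

      0<4PP : 0ℚ < ι 4 * (P * P)
      0<4PP = *-mono-0< {ι 4} {P * P} (0<ι-suc 3) (*-mono-0< {P} {P} 0<P 0<P)

      0<η : 0ℚ < η
      0<η = inv-0< 0<4PP

      0<largestFactor : 0ℚ < largestFactor
      0<largestFactor = <-≤-trans 0<CP (≤-from (C * P) (P * (C + 1ℚ) + ι 2 * V)
        (+-mono-0≤ {P * (C + 1ℚ)} {ι 2 * V} (*-mono-0≤ {P} {C + 1ℚ} 0≤P (+-mono-0≤ {C} {1ℚ} 0≤C (<⇒≤ 0<1))) (*-mono-0≤ {ι 2} {V} (0≤ι 2) 0≤V))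
        (solve 3 (λ C P V → P :* (C :+ con 1ℚ) :+ P :* C :+ con (ι 2) :* V := C :* P :+ (P :* (C :+ con 1ℚ) :+ con (ι 2) :* V)) refl C P V))

      0<ε : 0ℚ < ε
      0<ε = *-mono-0< {½} {inv largestFactor} (positive⁻¹ ½) (inv-0< 0<largestFactor)

      η≤¼ : η ≤ ¼
      η≤¼ = inv-≤ {ι 4 * (P * P)} {¼} 0<4PP (begin
        1ℚ                    ≤⟨ *-mono {1ℚ} {P} {1ℚ} {P} (<⇒≤ 0<1) 0≤P 1≤P 1≤P ⟩
        P * P                 ≡⟨ solve 1 (λ p → p := con (ι 4) :* p :* con ¼) refl (P * P) ⟩
        ι 4 * (P * P) * ¼     ∎)

      PPη≡¼ : P * P * η ≡ ¼
      PPη≡¼ = trans (solve 2 (λ p η → p :* η := con ¼ :* (con (ι 4) :* p :* η)) refl (P * P) η)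
        (cong (¼ *_) (*-inv (ι 4 * (P * P)) (0<⇒≢0 0<4PP)))

      module _ (s : ℚ) (-½≤s : 0ℚ ≤ s + ½) (s²≈ : ∣ s * s - ι (c ℕ.* (c ℕ.+ 1)) ∣ < η) where

        u = s * s - C * (C + 1ℚ)

        ∣u∣≤η : ∣ u ∣ ≤ η
        ∣u∣≤η = subst (λ i → ∣ s * s - i ∣ ≤ η) (trans (ι-* c (c ℕ.+ 1)) (cong (C *_) (ι-+ c 1))) (<⇒≤ s²≈)

        u≤η : u ≤ η
        u≤η = ≤-trans (p≤∣p∣ u) ∣u∣≤η

        -η≤u : - η ≤ u
        -η≤u = ≤-trans (neg-antimono-≤ ∣u∣≤η) (-∣p∣≤p u)

        -- The approximation `s` is only known to be at least -1 / 2, but with C ≥ 1 the sum s + C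
        -- is positive, which excludes the negative root.
        C≤s : C ≤ s
        C≤s = square-cancel-≤ {C} {s}
          (<-≤-trans (positive⁻¹ ½) (≤-from ½ ((s + ½) + (C - 1ℚ)) (+-mono-0≤ {s + ½} {C - 1ℚ} -½≤s (0≤q-p 1≤C))
            (solve 2 (λ s C → s :+ C := con ½ :+ ((s :+ con ½) :+ (C :- con 1ℚ))) refl s C)))
          (≤-from (C * C) ((u - - η) + (¼ - η) + (C - ¼))
            (+-mono-0≤ {(u - - η) + (¼ - η)} {C - ¼} (+-mono-0≤ {u - - η} {¼ - η} (0≤q-p -η≤u) (0≤q-p η≤¼))
              (0≤q-p (≤-trans (<⇒≤ ¼<1) 1≤C)))
            (solve 3 (λ s C η → s :* s := C :* C :+ ((s :* s :- C :* (C :+ con 1ℚ) :- :- η) :+ (con ¼ :- η) :+ (C :- con ¼))) refl s C η))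
          where
          ¼<1 : ¼ < 1ℚ
          ¼<1 = *<* (ℤ.+<+ (ℕ.s≤s (ℕ.s≤s ℕ.z≤n)))

        0≤s : 0ℚ ≤ s
        0≤s = ≤-trans 0≤C C≤s

        s≤C+1 : s ≤ C + 1ℚ
        s≤C+1 = square-cancel-≤ {s} {C + 1ℚ}
          (<-≤-trans 0<1 (≤-from 1ℚ (C + s) (+-mono-0≤ {C} {s} 0≤C 0≤s) (solve 2 (λ s C → C :+ con 1ℚ :+ s := con 1ℚ :+ (C :+ s)) refl s C)))
          (≤-from (s * s) ((η - u) + (¼ - η) + (C + + 3 / 4))
            (+-mono-0≤ {(η - u) + (¼ - η)} {C + + 3 / 4} (+-mono-0≤ {η - u} {¼ - η} (0≤q-p u≤η) (0≤q-p η≤¼))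
              (+-mono-0≤ {C} {+ 3 / 4} 0≤C (<⇒≤ (positive⁻¹ (+ 3 / 4)))))
            (solve 3 (λ s C η → (C :+ con 1ℚ) :* (C :+ con 1ℚ) := s :* s :+ ((η :- (s :* s :- C :* (C :+ con 1ℚ))) :+ (con ¼ :- η) :+ (C :+ con (+ 3 / 4)))) refl s C η))

        y = ι 4 - C + s
        e = P * s - (P * C + ι 2 * V)
        factor = P * s + P * C + ι 2 * V

        -- The product P² s² - (P C + 2 V)² is minus the norm of p w - 2 v, up to the error `u` in
        -- s².
        eF≡ : e * factor ≡ P * P * u + C
        eF≡ = begin-equality
          e * factor                                                                      ≡⟨ solve 4 (λ P V C s → (P :* s :- (P :* C :+ con (ι 2) :* V)) :* (P :* s :+ P :* C :+ con (ι 2) :* V)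
                                                                                                := P :* P :* (s :* s :- C :* (C :+ con 1ℚ)) :+ C :* (P :* P) :- (con (ι 4) :* (C :* (P :* V)) :+ con (ι 4) :* (V :* V))) refl P V C s ⟩
          P * P * u + C * (P * P) - (ι 4 * (C * (P * V)) + ι 4 * (V * V))                 ≡⟨ cong (λ i → P * P * u + i - (ι 4 * (C * (P * V)) + ι 4 * (V * V))) (pell sol) ⟩
          P * P * u + (ι 4 * (C * (P * V)) + ι 4 * (V * V) + C) - (ι 4 * (C * (P * V)) + ι 4 * (V * V))
                                                                                          ≡⟨ solve 3 (λ a b C → a :+ (b :+ C) :- b := a :+ C) refl (P * P * u) (ι 4 * (C * (P * V)) + ι 4 * (V * V)) C ⟩
          P * P * u + C                                                                   ∎

        eF≤ : e * factor ≤ + 5 / 4 * C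
        eF≤ = begin
          e * factor              ≡⟨ eF≡ ⟩
          P * P * u + C           ≤⟨ +-monoˡ-≤ C (*-monoˡ {u} {η} (P * P) (*-mono-0≤ {P} {P} 0≤P 0≤P) u≤η) ⟩
          P * P * η + C           ≡⟨ cong (_+ C) PPη≡¼ ⟩
          ¼ + C                   ≤⟨ +-monoˡ-≤ C (*-monoˡ {1ℚ} {C} ¼ (<⇒≤ (positive⁻¹ ¼)) 1≤C) ⟩
          ¼ * C + C               ≡⟨ solve 1 (λ C → con ¼ :* C :+ C := con (+ 5 / 4) :* C) refl C ⟩
          + 5 / 4 * C             ∎

        ½≤eF : ½ ≤ e * factor
        ½≤eF = begin
          ½                       ≤⟨ ≤-from ½ ¼ (<⇒≤ (positive⁻¹ ¼)) refl ⟩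
          - ¼ + 1ℚ                ≤⟨ +-monoʳ-≤ (- ¼) 1≤C ⟩
          - ¼ + C                 ≡⟨ cong (λ i → - i + C) PPη≡¼ ⟨
          - (P * P * η) + C       ≡⟨ solve 3 (λ p η C → :- (p :* η) :+ C := p :* (:- η) :+ C) refl (P * P) η C ⟩
          P * P * (- η) + C       ≤⟨ +-monoˡ-≤ C (*-monoˡ { - η} {u} (P * P) (*-mono-0≤ {P} {P} 0≤P 0≤P) -η≤u) ⟩
          P * P * u + C           ≡⟨ eF≡ ⟨
          e * factor              ∎

        factor≤ : factor ≤ largestFactor
        factor≤ = +-monoˡ-≤ (ι 2 * V) (+-monoˡ-≤ (P * C) (*-monoˡ {s} {C + 1ℚ} P 0≤P s≤C+1))

        2CP≤factor : ι 2 * (C * P) ≤ factor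
        2CP≤factor = begin
          ι 2 * (C * P)             ≡⟨ solve 2 (λ C P → con (ι 2) :* (C :* P) := P :* C :+ P :* C) refl C P ⟩
          P * C + P * C             ≤⟨ +-monoˡ-≤ (P * C) (*-monoˡ {C} {s} P 0≤P C≤s) ⟩
          P * s + P * C             ≤⟨ p≤p+q {P * s + P * C} {ι 2 * V} (*-mono-0≤ {ι 2} {V} (0≤ι 2) 0≤V) ⟩
          factor                    ∎

        0<factor : 0ℚ < factor
        0<factor = <-≤-trans (*-mono-0< {ι 2} {C * P} (0<ι-suc 1) 0<CP) 2CP≤factor

        ε≤e : ε ≤ e
        ε≤e = *-cancelˡ-≤ factor 0<factor (begin
          factor * ε                                ≤⟨ *-monoʳ {factor} {largestFactor} ε (<⇒≤ 0<ε) factor≤ ⟩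
          largestFactor * (½ * inv largestFactor)   ≡⟨ solve 2 (λ f i → f :* (con ½ :* i) := con ½ :* (f :* i)) refl largestFactor (inv largestFactor) ⟩
          ½ * (largestFactor * inv largestFactor)   ≡⟨ cong (½ *_) (*-inv largestFactor (0<⇒≢0 0<largestFactor)) ⟩
          ½                                         ≤⟨ ½≤eF ⟩
          e * factor                                ≡⟨ *-comm e factor ⟩
          factor * e                                ∎)

        0≤e : 0ℚ ≤ e
        0≤e = ≤-trans (<⇒≤ 0<ε) ε≤e

        -- The excess is the perturbed norm, at most 5 C / 4, divided by a conjugate factor of at
        -- least 2 C P.
        Pe≤⅝ : P * e ≤ + 5 / 8
        Pe≤⅝ = *-cancelˡ-≤ (ι 2 * C) (*-mono-0< {ι 2} {C} (0<ι-suc 1) (<-≤-trans 0<1 1≤C)) (begin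
          ι 2 * C * (P * e)       ≡⟨ solve 3 (λ C P e → con (ι 2) :* C :* (P :* e) := e :* (con (ι 2) :* (C :* P))) refl C P e ⟩
          e * (ι 2 * (C * P))     ≤⟨ *-monoˡ {ι 2 * (C * P)} {factor} e 0≤e 2CP≤factor ⟩
          e * factor              ≤⟨ eF≤ ⟩
          + 5 / 4 * C             ≡⟨ solve 1 (λ C → con (+ 5 / 4) :* C := con (ι 2) :* C :* con (+ 5 / 8)) refl C ⟩
          ι 2 * C * (+ 5 / 8)     ∎)

        4≤y : ι 4 ≤ y
        4≤y = ≤-from (ι 4) (s - C) (0≤q-p C≤s) (solve 2 (λ s C → con (ι 4) :- C :+ s := con (ι 4) :+ (s :- C)) refl s C)

        y≤5 : y ≤ ι 5
        y≤5 = ≤-from y (C + 1ℚ - s) (0≤q-p s≤C+1) (solve 2 (λ s C → con (ι 5) := con (ι 4) :- C :+ s :+ (C :+ con 1ℚ :- s)) refl s C)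

        -- From n = 2 P + V ≤ 3 P follows 8 n e ≤ 24 P e ≤ 15, while y² ≥ 16; the tolerance 1 / 4 in
        -- `η` is small enough to keep this order.
        solution⇒approximates : Approximates n (m sol) ε y
        solution⇒approximates = excess⇒approximates e
          (begin-equality
            P * y                         ≡⟨ solve 4 (λ P V C s → P :* (con (ι 4) :- C :+ s) := con (ι 2) :* (con (ι 2) :* P :+ V) :+ (P :* s :- (P :* C :+ con (ι 2) :* V))) refl P V C s ⟩
            ι 2 * (ι 2 * P + V) + e       ≡⟨ cong (λ i → ι 2 * i + e) n≡ ⟨
            ι 2 * ι n + e                 ∎)
          ε≤e
          (begin
            ι 8 * ι n * e                 ≡⟨ cong (λ i → ι 8 * i * e) n≡ ⟩
            ι 8 * (ι 2 * P + V) * e       ≤⟨ *-monoʳ {ι 8 * (ι 2 * P + V)} {ι 8 * (ι 2 * P + P)} e 0≤e (*-monoˡ {ι 2 * P + V} {ι 2 * P + P} (ι 8) (0≤ι 8) (+-monoʳ-≤ (ι 2 * P) V≤P)) ⟩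
            ι 8 * (ι 2 * P + P) * e       ≡⟨ solve 2 (λ P e → con (ι 8) :* (con (ι 2) :* P :+ P) :* e := con (ι 24) :* (P :* e)) refl P e ⟩
            ι 24 * (P * e)                ≤⟨ *-monoˡ {P * e} {+ 5 / 8} (ι 24) (0≤ι 24) Pe≤⅝ ⟩
            ι 15                          ≤⟨ ι-mono {15} {16} (ℕₚ.n≤1+n 15) ⟩
            ι 4 * ι 4                     ≤⟨ *-mono {ι 4} {y} {ι 4} {y} (0≤ι 4) (≤-trans (0≤ι 4) 4≤y) 4≤y 4≤y ⟩
            y * y                         ∎)
          (≤-trans (ι-mono {1} {4} (ℕ.s≤s ℕ.z≤n)) 4≤y)
          (≤-trans (*-monoˡ {y} {ι 5} (ι 4) (0≤ι 4) y≤5)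
            (ι-mono {20} {n} (ℕₚ.≤-trans 20≤v v≤n)))

-- Passage from approximations to real numbers

open import Defs
open RationalSequences using (ι; /1-+; p≤p+q; convergent; inv)
open RationalEstimates
open QuotientsFour
open Pell

≈-refl : ∀ x → x ≈ x
≈-refl x ε 0<ε = 0 , λ n _ → subst (λ d → ℚ.∣ d ∣ ℚ.< ε) (sym (ℚₚ.+-inverseʳ (seq x n))) 0<ε

≤-eventually : ∀ x y N → (∀ k → N ℕ.≤ k → seq x k ℚ.≤ seq y k) → x ≤ y
≤-eventually x y N x≤y ε 0<ε = N , λ k N≤k → ℚₚ.≤-trans (x≤y k N≤k) (p≤p+q {seq y k} {ε} (ℚₚ.<⇒≤ 0<ε))

-- Here `y` is itself a logarithm of `exp y`, and exp (y / n) is the power, so the graph conditions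
-- hold by reflexivity and only termwise floor bounds remain. The threshold 4 is the number of terms
-- needed by the upper bound on the partial sums.
approximates⇒𝒜 : ∀ y n m .{{_ : NonZero n}} ε → 0ℚ ℚ.< ε → ∀ N →
                   (∀ k → N ℕ.≤ k → Approximates n m ε (seq y k)) → 𝒜 (exp y) n
approximates⇒𝒜 y n m ε 0<ε N appr =
  ℕ.≢-nonZero (ℕ.≢-nonZero⁻¹ n) , + m , ℤ.pred (+ m) ,
  (r , (y , ≈-refl (exp y) , ≈-refl r) , r-1#0 ,
    ≤-eventually (fromℕ m) ((r - fromℕ 1) ⁻¹⟨ r-1#0 ⟩) (4 ℕ.⊔ N) (λ k k≥ → at.m≤inv[e-1] k (N≤ k≥) (4≤ k≥)) ,
    ½ , ℚₚ.positive⁻¹ ½ , 4 ℕ.⊔ N , λ k k≥ → subst (_ ℚ.≤_) (sym (/1-+ (+ m) ℤ.1ℤ)) (at.inv[e-1]+½≤m+1 k (N≤ k≥) (4≤ k≥))) ,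
  (y , ≈-refl (exp y) , y#0 ,
    ≤-eventually (fromℤ (ℤ.pred (+ m))) (fromℕ n * y ⁻¹⟨ y#0 ⟩ - fromℚ ½) N (λ k N≤k → subst (ℚ._≤ _) (sym pred-m≡) (at.m-1≤n/y-½ k N≤k)) ,
    -- The value of `gap` involves only `ε` and `n`, so index `N` can name it for all later indices.
    at.gap N ℕₚ.≤-refl , at.0<gap N ℕₚ.≤-refl , N ,
    λ k N≤k → subst (_ ℚ.≤_) (cong (_/ 1) (sym pred-m+1≡m)) (at.n/y-½+gap≤m k N≤k)) ,
  λ m≡pred → ℤₚ.i≢suc[i] (sym (trans (cong ℤ.suc m≡pred) (ℤₚ.suc-pred (+ m))))
  where
  r = exp (fromℚ (+ 1 / n) * y)
  module at k (N≤k : N ℕ.≤ k) = Scaled n m ε (seq y k) 0<ε (appr k N≤k)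
  4≤ : ∀ {k} → 4 ℕ.⊔ N ℕ.≤ k → 4 ℕ.≤ k
  4≤ = ℕₚ.m⊔n≤o⇒m≤o 4 N
  N≤ : ∀ {k} → 4 ℕ.⊔ N ℕ.≤ k → N ℕ.≤ k
  N≤ = ℕₚ.m⊔n≤o⇒n≤o 4 N
  r-1#0 : (r - fromℕ 1) #0
  r-1#0 = + 1 / n , at.0<1/n N ℕₚ.≤-refl , 4 ℕ.⊔ N , λ k k≥ → at.1/n≤∣e-1∣ k (N≤ k≥) (4≤ k≥)
  y#0 : y #0
  y#0 = 1ℚ , ℚₚ.positive⁻¹ 1ℚ , N , λ k N≤k →
    subst (1ℚ ℚ.≤_) (sym (ℚₚ.0≤p⇒∣p∣≡p (ℚₚ.<⇒≤ (at.0<y k N≤k)))) (Approximates.1≤y (appr k N≤k))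
  pred-m≡ : ℤ.pred (+ m) / 1 ≡ ι m ℚ.- 1ℚ
  pred-m≡ = trans (/1-+ ℤ.-1ℤ (+ m)) (ℚₚ.+-comm (ℚ.- 1ℚ) (ι m))
  pred-m+1≡m : ℤ.pred (+ m) ℤ.+ ℤ.1ℤ ≡ + m
  pred-m+1≡m = trans (ℤₚ.+-comm (ℤ.pred (+ m)) ℤ.1ℤ) (ℤₚ.suc-pred (+ m))

theorem6 : ((a : ContinuedFraction) (a₀≡0 : quotient a 0 ≡ + 0) →
    quotient a 1 ≡ + 2 →
    (∀ k → 1 ≤ℕ k → quotient a (2 *ℕ k) ≡ + 4) →
    Infinite (𝒜 (exp (fromℕ 2 * value a ⁻¹⟨ value#0 a a₀≡0 ⟩))))
    ×
    ((c : ℕ) .{{_ : NonZero c}} (s : ℝ) →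
    Is√ (fromℕ (c *ℕ (c +ℕ 1))) s →
    Infinite (𝒜 (exp (fromℕ 4 - fromℕ c + s))))
theorem6 = continuedFractions , squareRoots
  where
  continuedFractions : (a : ContinuedFraction) (a₀≡0 : quotient a 0 ≡ + 0) → quotient a 1 ≡ + 2 →
                       (∀ k → 1 ≤ℕ k → quotient a (2 *ℕ k) ≡ + 4) →
                       Infinite (𝒜 (exp (fromℕ 2 * value a ⁻¹⟨ value#0 a a₀≡0 ⟩)))
  continuedFractions a a₀≡0 a₁≡2 a₂ₖ≡4 N =
    let i , b , f , s , N+24+2≤q = convergents-far (N ℕ.+ 24) fours (convergents-start {quotient a} a₀≡0 a₁≡2 (positive a ∘ suc))
        open Convergents s using (m; q; 0<q)
        N+24≤q = ℕₚ.≤-trans (ℕₚ.m≤m+n (N ℕ.+ 24) 2) N+24+2≤q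
        24≤q = ℕₚ.≤-trans (ℕₚ.m≤n+m 24 N) N+24≤q
        open MöbiusExcess f s 24≤q using (ε; 0<ε; convergents⇒approximates)
    in q , ℕₚ.≤-trans (ℕₚ.m≤m+n N 24) N+24≤q ,
      -- The offset counts the initial quotients 0, 2 and the `i` quotients passed before the
      -- denominator is large enough.
      approximates⇒𝒜 (fromℕ 2 * value a ⁻¹⟨ value#0 a a₀≡0 ⟩) q m {{ℕ.>-nonZero 0<q}} ε 0<ε (2 ℕ.+ i) λ k 2+i≤k →
        let j = k ℕ.∸ (2 ℕ.+ i)
            open FirstQuotients {quotient a} a₀≡0 a₁≡2 (positive a ∘ suc) (i ℕ.+ j) using (y; cy≡2; 4≤y; y≤6)
        in subst (λ k → Approximates q m ε (ι 2 ℚ.* inv (convergent (quotient a) k))) (ℕₚ.m+[n∸m]≡n 2+i≤k)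
             (convergents⇒approximates j y cy≡2 4≤y y≤6)
    where
    fours : Fours (quotient a ∘ suc ∘ suc)
    fours = record
      { positive = positive a ∘ suc
      ; four     = λ k → subst (λ i → quotient a i ≡ + 4) (ℕₚ.*-suc 2 k) (a₂ₖ≡4 (suc k) (ℕ.s≤s ℕ.z≤n)) }

  squareRoots : (c : ℕ) .{{_ : NonZero c}} (s : ℝ) → Is√ (fromℕ (c *ℕ (c +ℕ 1))) s →
                Infinite (𝒜 (exp (fromℕ 4 - fromℕ c + s)))
  squareRoots c s (0≤s , s²≈) N =
    let sol , N+20≤v = largeSolution c (N ℕ.+ 20)
        20≤v = ℕₚ.≤-trans (ℕₚ.m≤n+m 20 N) N+20≤v
        open Solution sol using (m)
        open PellExcess c sol 20≤v using (n; v≤n; η; 0<η; ε; 0<ε; solution⇒approximates)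
        -- Nonnegativity of the real root yields only a lower bound with tolerance for its terms; 1
        -- / 2 suffices since c ≥ 1.
        K , -½≤s = 0≤s ½ (ℚₚ.positive⁻¹ ½)
        L , s²-near = s²≈ η 0<η
    in n , ℕₚ.≤-trans (ℕₚ.m≤m+n N 20) (ℕₚ.≤-trans N+20≤v v≤n) ,
      approximates⇒𝒜 (fromℕ 4 - fromℕ c + s) n m {{ℕ.>-nonZero (ℕₚ.≤-trans (ℕ.s≤s ℕ.z≤n) (ℕₚ.≤-trans 20≤v v≤n))}} ε 0<ε (K ℕ.⊔ L) λ k k≥ →
        solution⇒approximates (seq s k) (-½≤s k (ℕₚ.m⊔n≤o⇒m≤o K L k≥)) (s²-near k (ℕₚ.m⊔n≤o⇒n≤o K L k≥))
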